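{- Let $B$ be a match-exhaustive B-ESG grammar. Then the match-enumeration problem for $B$ is decidable: there is an algorithm which, given a string graph $H$, enumerates (and terminates after listing) all concrete derivations $S\Rightarrow^B_* K$ such that there exists a matching $m:K\to\widetilde H$ for some string graph $\widetilde H$ wire-homeomorphic to $H$.
   Context: Graphs: a graph over $\Sigma,\Gamma$ is $H=(V,E,\lambda)$ with $V$ finite, $E\subseteq\{(v,\gamma,w): v\neq w,\gamma\in\Gamma\}$, $\lambda:V\to\Sigma$. A graph with embedding is $(D,C)$ with $C\subseteq\Sigma\times\Gamma\times\Gamma\times V_D\times\{in,out\}$, elements written $(\sigma,\beta/\gamma,x,d)$. An edNCE grammar $G=(\Sigma,\Delta,\Gamma,\Omega,P,S)$ has terminal labels $\Delta$, final edge labels $\Omega$, finitely many productions $X\to(D,C)$ ($X$ non-terminal) and initial non-terminal $S$. Applying $X\to(D,C)$ to an $X$-labelled vertex $v$: delete $v$, add a copy of $D$, and for every $\beta$-edge between $v$ and a $\sigma$-labelled vertex $w$ directed into $v$ ($d=in$) or out of $v$ ($d=out$) and each $(\sigma,\beta/\gamma,x,d)\in C$, add a $\gamma$-edge between $w$ and $x$ ($w\to x$ if $d=in$, $x\to w$ if $d=out$). Derivations start from a single $S$-labelled vertex. B-edNCE: production bodies have no adjacent non-terminals and no instruction has non-terminal $\sigma$. String graphs: for disjoint label sets $\mathcal N$ (node-vertices), $\mathcal W$ (wire-vertices), a string graph is a directed graph labelled in $\mathcal N\cup\mathcal W$ with no edge between node-vertices and all wire-vertices of in- and out-degree at most one.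 Inputs/outputs: wire-vertices with no incoming/outgoing edges; the boundary is the set of inputs and outputs. A wire is a maximal connected subgraph consisting of wire-vertices and containing at least one edge; a bare wire is a wire that is a chain not connected to any node-vertex. Wire-homeomorphism $G\sim G'$: $G'$ is obtained from $G$ by finitely many mergings of two adjacent wire-vertices into one or splittings of a wire-vertex into two adjacent wire-vertices. A string graph homomorphism is a label-preserving graph homomorphism. A matching of a string graph $L$ with boundary $B_L$ onto a string graph $H$ is an injective string graph homomorphism $m:L\to\widetilde H$ with $\widetilde H\sim H$ such that every edge incident to $m(L)$ (i.e. joining a vertex of $m(L)$ to a vertex outside it) is incident to $m(B_L)$. Encoded string graph: a string graph where edges labelled by encoding symbols $\alpha\in\mathcal E$ ($\mathcal E$ finite) may additionally join node-vertices. Decoding system $T$: for each $(\alpha,N_1,N_2)\in\mathcal E\times\mathcal N\times\mathcal N$ one DPO rule replacing a single $\alpha$-edge from an $N_1$ node-vertex to an $N_2$ node-vertex (interface: the two node-vertices) by a connected string graph with no inputs, outputs or encoding labels. B-ESG grammar $B=(G,T)$: $T$ a decoding system, $G=(\Sigma,\Delta,\Gamma,\Gamma,P,S)$ B-edNCE with $\Delta=\mathcal N\cup\mathcal W$, $\mathcal E\subseteq\Gamma$, and for each production $X\to(D,C)$: (N1) an edge of $D$ has encoding label iff it joins two node-vertices; (N2) instructions $(N,\alpha/\beta,x,d)$ with $N\in\mathcal N$, $x$ a node-vertex have $\beta\in\mathcal E$; (W1) wire-vertices of $D$ have in- and out-degree at most one; (W2) no instruction $(\sigma,\alpha/\beta,x,d)$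 has $x$ a wire-vertex; (W3) for each $W\in\mathcal W,\gamma,d$ at most one instruction $(W,\gamma/\delta,x,d)$, and $\delta\notin\mathcal E$; (W4) if a non-terminal $y$ with label $Y$ in $D$ is adjacent to a $W$-labelled wire-vertex via an edge of direction $d$ and label $\beta$, or there is an instruction $(W,\alpha/\beta,y,d)$, then all productions for $Y$ contain an instruction $(W,\beta/\gamma,z,d)$. A concrete derivation $S\Rightarrow^B_*K$ is a derivation $S\Rightarrow^G_*H_1$ with $H_1$ free of non-terminals followed by decoding $H_1\Rightarrow^T_*K$. Match-exhaustive: $B$ is match-exhaustive if (1) every production $X\to(D,C)$ whose body $D$ contains a bare wire has a finite bound on the number of times it can be expanded in any sentential form, (2) no production body contains an isolated wire-vertex, (3) there are no empty productions (empty body), and (4) there is no production whose body consists of a single non-terminal vertex. -}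

module Defs where

open import Data.Nat using (ℕ; zero; suc; _+_; _≤_; _≡ᵇ_)
open import Data.Fin using (Fin; zero; suc; splitAt; punchIn; inject₁; _↑ˡ_; _↑ʳ_; fromℕ)
import Data.Fin as Fin
import Data.Fin.Properties as FinP
open import Data.Bool using (Bool; true; false; _∧_; _∨_; not; if_then_else_)
open import Data.Sum using (_⊎_; inj₁; inj₂)
open import Data.Product using (Σ; _×_; _,_; proj₁; proj₂)
open import Data.Maybe using (Maybe; just; nothing)
open import Data.List using (List; []; _∷_; allFin; length; filterᵇ)
open import Data.Bool.ListAction using (any)
open import Data.List.Membership.Propositional using (_∈_)
open import Relation.Binary.PropositionalEquality using (_≡_; _≢_)
open import Relation.Nullary using (¬_; does)
open import Relation.Binary.Construct.Closure.Equivalence using (EqClosure)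

-- Alphabets.  A signature fixes finitely many node-vertex labels (𝒩),
-- wire-vertex labels (𝒲), non-terminal labels, encoding edge labels (ℰ)
-- and other (non-encoding) edge labels.  Σ = 𝒩 ⊎ 𝒲 ⊎ non-terminals,
-- Δ = 𝒩 ∪ 𝒲, Γ = ℰ ⊎ others.

record Sig : Set where
  field
    nNode nWire nNT nEnc nPlain : ℕ

module _ (s : Sig) where
  open Sig s

  data Lab : Set where
    node : Fin nNode → Lab
    wire : Fin nWire → Lab
    nt   : Fin nNT → Lab

  data ELab : Set where
    enc   : Fin nEnc → ELab
    plain : Fin nPlain → ELab

-- a concrete derivation is recorded by its grammar steps (vertex, production
-- index) followed by its decoding steps (source, target, encoding symbol)
CDeriv : Set
CDeriv = List (ℕ × ℕ) × List (ℕ × ℕ × ℕ)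

_==F_ : ∀ {n} → Fin n → Fin n → Bool
a ==F b = does (a Fin.≟ b)

data Dir : Set where
  inD outD : Dir

_==D_ : Dir → Dir → Bool
inD ==D inD = true
outD ==D outD = true
_ ==D _ = false

module _ {s : Sig} where

  isNode : Lab s → Bool
  isNode (node _) = true
  isNode _ = false

  isWire : Lab s → Bool
  isWire (wire _) = true
  isWire _ = false

  isNT : Lab s → Bool
  isNT (nt _) = true
  isNT _ = false

  isEnc : ELab s → Bool
  isEnc (enc _) = true
  isEnc (plain _) = false

  _==L_ : Lab s → Lab s → Bool
  node a ==L node b = a ==F b
  wire a ==L wire b = a ==F b
  nt a ==L nt b = a ==F b
  _ ==L _ = false

  _==E_ : ELab s → ELab s → Bool
  enc a ==E enc b = a ==F b
  plain a ==E plain b = a ==F b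
  _ ==E _ = false

-- Graphs: vertex set Fin n, labelling, and edge set given by its
-- (decidable) characteristic function: edge v w γ ≡ true iff (v,γ,w) ∈ E.
-- The condition v ≠ w is imposed separately by `Loopless`.

record Graph (s : Sig) : Set where
  field
    n    : ℕ
    lab  : Fin n → Lab s
    edge : Fin n → Fin n → ELab s → Bool
open Graph public

module _ {s : Sig} where

  Loopless : Graph s → Set
  Loopless G = ∀ v γ → edge G v v γ ≡ false

  InDeg≤1 : (G : Graph s) → Fin (n G) → Set
  InDeg≤1 G v = ∀ a b γ δ → edge G a v γ ≡ true → edge G b v δ ≡ true → (a ≡ b) × (γ ≡ δ)

  OutDeg≤1 : (G : Graph s) → Fin (n G) → Set
  OutDeg≤1 G v = ∀ a b γ δ → edge G v a γ ≡ true → edge G v b δ ≡ true → (a ≡ b) × (γ ≡ δ)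

  record IsStringGraph (G : Graph s) : Set where
    field
      loopless  : Loopless G
      terminal  : ∀ v → isNT (lab G v) ≡ false
      noNodeNode : ∀ v w γ → isNode (lab G v) ≡ true → isNode (lab G w) ≡ true → edge G v w γ ≡ false
      wireIn    : ∀ v → isWire (lab G v) ≡ true → InDeg≤1 G v
      wireOut   : ∀ v → isWire (lab G v) ≡ true → OutDeg≤1 G v

  IsInput : (G : Graph s) → Fin (n G) → Set
  IsInput G v = (isWire (lab G v) ≡ true) × (∀ a γ → edge G a v γ ≡ false)

  IsOutput : (G : Graph s) → Fin (n G) → Set
  IsOutput G v = (isWire (lab G v) ≡ true) × (∀ a γ → edge G v a γ ≡ false)

  IsBoundary : (G : Graph s) → Fin (n G) → Set
  IsBoundary G v = IsInput G v ⊎ IsOutput G v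

  data Conn (G : Graph s) : Fin (n G) → Fin (n G) → Set where
    here : ∀ {a} → Conn G a a
    fwd  : ∀ {a b c} γ → edge G a b γ ≡ true → Conn G b c → Conn G a c
    bwd  : ∀ {a b c} γ → edge G b a γ ≡ true → Conn G b c → Conn G a c

  Connected : Graph s → Set
  Connected G = ∀ a b → Conn G a b

  record Iso (G H : Graph s) : Set where
    field
      to   : Fin (n G) → Fin (n H)
      from : Fin (n H) → Fin (n G)
      from∘to : ∀ a → from (to a) ≡ a
      to∘from : ∀ b → to (from b) ≡ b
      labPres  : ∀ a → lab H (to a) ≡ lab G a
      edgePres : ∀ a b γ → edge H (to a) (to b) γ ≡ edge G a b γ

  -- Splitting the wire-vertex v into two adjacent wire-vertices
  -- v →(γ) v' (the new vertex v' is `zero`, the old vertex a is `suc a`):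
  -- v keeps its incoming edges, v' takes over its outgoing edges, and
  -- v' carries the same label as v.
  splitGraph : (G : Graph s) → Fin (n G) → ELab s → Graph s
  splitGraph G v γ = record { n = suc (n G) ; lab = lab' ; edge = edge' }
    where
    lab' : Fin (suc (n G)) → Lab s
    lab' zero = lab G v
    lab' (suc a) = lab G a
    edge' : Fin (suc (n G)) → Fin (suc (n G)) → ELab s → Bool
    edge' (suc a) (suc b) δ = not (a ==F v) ∧ edge G a b δ
    edge' zero (suc b) δ = edge G v b δ
    edge' (suc a) zero δ = (a ==F v) ∧ (δ ==E γ)
    edge' zero zero δ = false

  data SplitStep (G : Graph s) : Graph s → Set where
    split : ∀ v γ → isWire (lab G v) ≡ true → SplitStep G (splitGraph G v γ)

  -- one elementary step: a splitting (its inverse, a merging, is obtained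
  -- through the symmetric closure) or a renaming of vertices
  data WStep (G H : Graph s) : Set where
    splitS : SplitStep G H → WStep G H
    isoS   : Iso G H → WStep G H

  WireHom : Graph s → Graph s → Set
  WireHom = EqClosure WStep

  record Matching (L H : Graph s) : Set where
    field
      m        : Fin (n L) → Fin (n H)
      injective : ∀ a b → m a ≡ m b → a ≡ b
      labPres  : ∀ a → lab H (m a) ≡ lab L a
      edgePres : ∀ a b γ → edge L a b γ ≡ true → edge H (m a) (m b) γ ≡ true
      boundaryOut : ∀ a b γ → edge H (m a) b γ ≡ true → (∀ c → m c ≢ b) → IsBoundary L a
      boundaryIn  : ∀ a b γ → edge H b (m a) γ ≡ true → (∀ c → m c ≢ b) → IsBoundary L a

  HasMatching : Graph s → Graph s → Set
  HasMatching K H = Σ (Graph s) λ H̃ → IsStringGraph H̃ × WireHom H H̃ × Matching K H̃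

  record Instr (k : ℕ) : Set where
    constructor instr
    field
      σ   : Lab s
      β   : ELab s
      γ   : ELab s
      x   : Fin k
      d   : Dir

  record Production : Set where
    field
      lhs  : Fin (Sig.nNT s)
      body : Graph s
      emb  : List (Instr (n body))
  open Production public

  -- canonical result of applying production p to vertex v of a graph with
  -- vertex set Fin (suc m): old vertices u ≠ v become `punchOut`-renumbered
  -- (Fin m, via punchIn), followed by the copy of the body.
  applyAt : ∀ {m} → (Fin (suc m) → Lab s) → (Fin (suc m) → Fin (suc m) → ELab s → Bool)
          → Fin (suc m) → Production → Graph s
  applyAt {m} labH eH v p = record { n = m + k ; lab = lab' ; edge = edge' }
    where
    k = n (body p)
    C = emb p
    lab' : Fin (m + k) → Lab s
    lab' a with splitAt m a
    ... | inj₁ u = labH (punchIn v u)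
    ... | inj₂ x = lab (body p) x
    edge' : Fin (m + k) → Fin (m + k) → ELab s → Bool
    edge' a b δ with splitAt m a | splitAt m b
    ... | inj₁ u | inj₁ w = eH (punchIn v u) (punchIn v w) δ
    ... | inj₂ x | inj₂ y = edge (body p) x y δ
    ... | inj₁ u | inj₂ x =
          any (λ i → (Instr.σ i ==L labH (punchIn v u)) ∧ (Instr.γ i ==E δ) ∧ (Instr.x i ==F x)
                     ∧ (Instr.d i ==D inD) ∧ eH (punchIn v u) v (Instr.β i)) C
    ... | inj₂ x | inj₁ u =
          any (λ i → (Instr.σ i ==L labH (punchIn v u)) ∧ (Instr.γ i ==E δ) ∧ (Instr.x i ==F x)
                     ∧ (Instr.d i ==D outD) ∧ eH v (punchIn v u) (Instr.β i)) C

  apply : (G : Graph s) → Fin (n G) → Production → Graph s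
  apply record { n = zero } () p
  apply record { n = suc m ; lab = l ; edge = e } v p = applyAt l e v p

  nth : ∀ {A : Set} → List A → ℕ → Maybe A
  nth [] _ = nothing
  nth (a ∷ as) zero = just a
  nth (a ∷ as) (suc i) = nth as i

  toFin? : (k : ℕ) → ℕ → Maybe (Fin k)
  toFin? zero _ = nothing
  toFin? (suc k) zero = just zero
  toFin? (suc k) (suc i) with toFin? k i
  ... | just j = just (suc j)
  ... | nothing = nothing

  startGraph : Fin (Sig.nNT s) → Graph s
  startGraph S = record { n = 1 ; lab = λ _ → nt S ; edge = λ _ _ _ → false }

  runG : List Production → Graph s → List (ℕ × ℕ) → Maybe (Graph s)
  runG P G [] = just G
  runG P G ((v , i) ∷ cs) with toFin? (n G) v | nth P i
  ... | just v' | just p =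
        if lab G v' ==L nt (lhs p) then runG P (apply G v' p) cs else nothing
  ... | _ | _ = nothing

  -- decoding rules.  The right-hand side is a graph on Fin (2 + k):
  -- vertex 0 is the N₁ interface node-vertex, vertex 1 the N₂ one.
  record Rule : Set where
    field
      k     : ℕ
      rlab  : Fin (suc (suc k)) → Lab s
      redge : Fin (suc (suc k)) → Fin (suc (suc k)) → ELab s → Bool

  rhs : Rule → Graph s
  rhs r = record { n = suc (suc (Rule.k r)) ; lab = Rule.rlab r ; edge = Rule.redge r }

  -- DPO application of a decoding rule at the α-edge v → w:
  -- delete that edge and glue in the right-hand side along v, w.
  decodeAt : (G : Graph s) → Fin (n G) → Fin (n G) → Fin (Sig.nEnc s) → Rule → Graph s
  decodeAt G v w α r = record { n = n G + k ; lab = lab' ; edge = edge' }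
    where
    k = Rule.k r
    N = n G
    f : Fin (suc (suc k)) → Fin (N + k)
    f zero = v ↑ˡ k
    f (suc zero) = w ↑ˡ k
    f (suc (suc x)) = N ↑ʳ x
    lab' : Fin (N + k) → Lab s
    lab' a with splitAt N a
    ... | inj₁ u = lab G u
    ... | inj₂ x = Rule.rlab r (suc (suc x))
    old : Fin (N + k) → Fin (N + k) → ELab s → Bool
    old a b δ with splitAt N a | splitAt N b
    ... | inj₁ u | inj₁ u' = edge G u u' δ ∧ not ((u ==F v) ∧ (u' ==F w) ∧ (δ ==E enc α))
    ... | _ | _ = false
    edge' : Fin (N + k) → Fin (N + k) → ELab s → Bool
    edge' a b δ = old a b δ ∨
      any (λ rr → any (λ ss → (f rr ==F a) ∧ (f ss ==F b) ∧ Rule.redge r rr ss δ) (allFin (suc (suc k))))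
          (allFin (suc (suc k)))

  DecSys : Set
  DecSys = Fin (Sig.nEnc s) → Fin (Sig.nNode s) → Fin (Sig.nNode s) → Rule

  runT : DecSys → Graph s → List (ℕ × ℕ × ℕ) → Maybe (Graph s)
  runT T G [] = just G
  runT T G ((v , w , a) ∷ ds) with toFin? (n G) v | toFin? (n G) w | toFin? (Sig.nEnc s) a
  ... | just v' | just w' | just α with lab G v' | lab G w'
  ...   | node N₁ | node N₂ =
          if edge G v' w' (enc α) then runT T (decodeAt G v' w' α (T α N₁ N₂) ) ds else nothing
  ...   | _ | _ = nothing
  runT T G (_ ∷ ds) | _ | _ | _ = nothing

  -- ESG grammars (alphabets fixed by the signature; Ω = Γ)
  record ESG : Set where
    field
      P : List Production
      S : Fin (Sig.nNT s)
      T : DecSys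

  NTFree : Graph s → Bool
  NTFree G = not (any (λ v → isNT (lab G v)) (allFin (n G)))

  concrete : ESG → CDeriv → Maybe (Graph s)
  concrete B (gs , ds) with runG (ESG.P B) (startGraph (ESG.S B)) gs
  ... | just H₁ = if NTFree H₁ then runT (ESG.T B) H₁ ds else nothing
  ... | nothing = nothing

  HasInstr : Production → Fin (Sig.nWire s) → ELab s → Dir → Set
  HasInstr p W β d = Σ (Instr (n (body p))) λ i →
    (i ∈ emb p) × (Instr.σ i ≡ wire W) × (Instr.β i ≡ β) × (Instr.d i ≡ d)

  AllHaveInstr : List Production → Fin (Sig.nNT s) → Fin (Sig.nWire s) → ELab s → Dir → Set
  AllHaveInstr P Y W β d = ∀ p' → p' ∈ P → lhs p' ≡ Y → HasInstr p' W β d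

  record ProdOK (P : List Production) (p : Production) : Set where
    D = body p
    C = emb p
    field
      loopless : Loopless D
      noAdjNT  : ∀ a b γ → isNT (lab D a) ≡ true → isNT (lab D b) ≡ true → edge D a b γ ≡ false
      noNTInstr : ∀ i → i ∈ C → isNT (Instr.σ i) ≡ false
      n1 : ∀ a b γ → edge D a b γ ≡ true → isEnc γ ≡ (isNode (lab D a) ∧ isNode (lab D b))
      n2 : ∀ i → i ∈ C → isNode (Instr.σ i) ≡ true → isNode (lab D (Instr.x i)) ≡ true
           → isEnc (Instr.γ i) ≡ true
      w1in  : ∀ a → isWire (lab D a) ≡ true → InDeg≤1 D a
      w1out : ∀ a → isWire (lab D a) ≡ true → OutDeg≤1 D a
      w2 : ∀ i → i ∈ C → isWire (lab D (Instr.x i)) ≡ false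
      w3unique : ∀ i j → i ∈ C → j ∈ C → isWire (Instr.σ i) ≡ true → Instr.σ i ≡ Instr.σ j
                 → Instr.β i ≡ Instr.β j → Instr.d i ≡ Instr.d j → i ≡ j
      w3enc : ∀ i → i ∈ C → isWire (Instr.σ i) ≡ true → isEnc (Instr.γ i) ≡ false
      w4in  : ∀ y Y a W β → lab D y ≡ nt Y → lab D a ≡ wire W → edge D a y β ≡ true
              → AllHaveInstr P Y W β inD
      w4out : ∀ y Y a W β → lab D y ≡ nt Y → lab D a ≡ wire W → edge D y a β ≡ true
              → AllHaveInstr P Y W β outD
      w4instr : ∀ i Y W → i ∈ C → lab D (Instr.x i) ≡ nt Y → Instr.σ i ≡ wire W
              → AllHaveInstr P Y W (Instr.γ i) (Instr.d i)

  record RuleOK (α : Fin (Sig.nEnc s)) (N₁ N₂ : Fin (Sig.nNode s)) (r : Rule) : Set where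
    field
      lab0 : Rule.rlab r zero ≡ node N₁
      lab1 : Rule.rlab r (suc zero) ≡ node N₂
      stringGraph : IsStringGraph (rhs r)
      connected : Connected (rhs r)
      noInputs  : ∀ a → ¬ IsInput (rhs r) a
      noOutputs : ∀ a → ¬ IsOutput (rhs r) a
      noEnc : ∀ a b γ → Rule.redge r a b γ ≡ true → isEnc γ ≡ false

  record IsBESG (B : ESG) : Set where
    field
      prods : ∀ p → p ∈ ESG.P B → ProdOK (ESG.P B) p
      rules : ∀ α N₁ N₂ → RuleOK α N₁ N₂ (ESG.T B α N₁ N₂)

  record BareWire (D : Graph s) : Set where
    field
      len : ℕ
      vs  : Fin (suc (suc len)) → Fin (n D)
      distinct : ∀ i j → vs i ≡ vs j → i ≡ j
      wires : ∀ i → isWire (lab D (vs i)) ≡ true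
      chain : ∀ (i : Fin (suc len)) → Σ (ELab s) λ γ → edge D (vs (inject₁ i)) (vs (suc i)) γ ≡ true
      startMax : ∀ b γ → isWire (lab D b) ≡ true → edge D b (vs zero) γ ≡ false
      endMax   : ∀ b γ → isWire (lab D b) ≡ true → edge D (vs (fromℕ (suc len))) b γ ≡ false
      noNodeOut : ∀ i b γ → isNode (lab D b) ≡ true → edge D (vs i) b γ ≡ false
      noNodeIn  : ∀ i b γ → isNode (lab D b) ≡ true → edge D b (vs i) γ ≡ false

  uses : ℕ → List (ℕ × ℕ) → ℕ
  uses i gs = length (filterᵇ (λ c → proj₂ c ≡ᵇ i) gs)

  record MatchExhaustive (B : ESG) : Set where
    P = ESG.P B
    field
      bareBounded : ∀ i p → nth P i ≡ just p → BareWire (body p) →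
        Σ ℕ λ bound → ∀ gs H → runG P (startGraph (ESG.S B)) gs ≡ just H → uses i gs ≤ bound
      noIsolatedWire : ∀ p → p ∈ P → ∀ a → isWire (lab (body p) a) ≡ true →
        Σ (Fin (n (body p))) λ b → Σ (ELab s) λ γ →
          (edge (body p) a b γ ≡ true) ⊎ (edge (body p) b a γ ≡ true)
      nonEmpty : ∀ p → p ∈ P → n (body p) ≢ 0
      notSingleNT : ∀ p → p ∈ P → ¬ ((n (body p) ≡ 1) × (∀ a → isNT (lab (body p) a) ≡ true))

{-# OPTIONS --safe #-}

-- Vertices of wire-homeomorphic graphs correspond to each other up to ≈, the equivalence generated by the edges
-- between equally labelled wire-vertices (Same).  For graphs in which such edges have been merged away except for
-- loops, a correspondence is an isomorphism up to loop labels, so wire-homeomorphism is decidable.  A host H̃ of a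
-- matching can be shrunk outside the image, and then has at most |K| + 2|H| vertices; this makes the existence of a
-- matching decidable.
--
-- To bound derivations, each step whose body contains a node-vertex, a wire-vertex next to a non-terminal or a closed
-- wire leaves a mark in the final graph: a node-vertex, a wire-vertex with a node-vertex at one side, or a closed
-- wire.  By (W4) the attachment to a non-terminal survives until a node-vertex takes over.  Each decoding step leaves
-- a mark as well.  Marked vertices of the same kind cannot share an ≈-class of H̃, so there are at most 4|H| marks.
-- The other steps use bare-wire productions, whose number is bounded by assumption, or bodies consisting of at least
-- two non-terminals, and of the latter there are fewer than of all the other steps together.

module Submission where

open import Defs
open import Data.Nat as ℕ using (ℕ; zero; suc; _+_; _*_; _≤_; _<_; z≤n; s≤s)
import Data.Nat.Properties as ℕₚ
open import Data.Nat.Solver using (module +-*-Solver)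
open import Data.Fin as Fin using (Fin; zero; suc; toℕ; punchIn; punchOut; splitAt; _↑ˡ_; _↑ʳ_; #_)
import Data.Fin.Properties as FinP
open import Data.Bool as Bool using (Bool; true; false; _∧_; _∨_; not; if_then_else_)
import Data.Bool.Properties as BoolP
open import Data.Bool.ListAction using (any)
open import Data.Sum using (_⊎_; inj₁; inj₂)
open import Data.Product using (Σ; _×_; _,_; proj₁; proj₂)
open import Data.Empty using (⊥; ⊥-elim)
open import Data.Maybe using (Maybe; just; nothing; maybe)
open import Data.Maybe.Properties using (just-injective)
open import Data.List using (List; []; _∷_; length; allFin; tabulate; foldr; map; concatMap; filter; upTo)
open import Data.List.Membership.Propositional using (_∈_; lose)
open import Data.List.Membership.Propositional.Properties
  using (∈-allFin; ∈-tabulate⁺; ∈-concatMap⁺; ∈-map⁺; ∈-upTo⁺; ∈-filter⁺; ∈-filter⁻)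
open import Data.List.Relation.Unary.Any using (here; there)
open import Data.Vec.Functional using () renaming (_∷_ to _∷ᵛ_)
open import Function using (_∘_; id; case_of_)
open import Relation.Nullary using (¬_; Dec; yes; no)
open import Relation.Nullary.Decidable using (_×-dec_; _→-dec_; _⊎-dec_; ¬?; map′; dec-true; dec-false)
open import Relation.Binary.Definitions using (tri<; tri≈; tri>)
open import Relation.Binary.PropositionalEquality
import Relation.Binary.Construct.Closure.Equivalence as Eq
import Relation.Binary.Construct.Closure.Symmetric as Sym
open import Relation.Binary.Construct.Closure.ReflexiveTransitive using (Star; ε; _◅_; _◅◅_)
import Algebra.Properties.CommutativeMonoid.Sum as Sum
open Eq using (EqClosure)
open Sum ℕₚ.+-0-commutativeMonoid using (sum; sum-remove; sum-cong-≗)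

-- Two obstacles shape the argument. The first is closed wires. If all their vertices have one
-- label, the last merge creates a loop and leaves the class of string graphs. So normal forms only
-- keep the degree bounds at wire-vertices, the label of a remaining loop is not an invariant,
-- correspondences need a separate invariant to tell open wires from closed ones, and a shrunk host
-- may keep two unmatched vertices per class, which is the 2 in its size bound. The second is that
-- wire-homeomorphism lengthens wires freely, so the size of `H` does not bound the size of `K`.
-- Only features that occur boundedly often per class can be counted: a node-vertex, a closed wire,
-- and a wire-vertex next to a node-vertex, once for each direction. These four kinds give the
-- constant 4. A mark is set at the step that creates it, when the later node-vertex may still be a
-- non-terminal; hence marks are defined for sentential forms and carried through all later steps.

-- Exhaustive search over finite types

Searchable : (A : Set) → (A → A → Set) → Set₁
Searchable A _≈_ =
  ∀ {P : A → Set} → (∀ {x y} → x ≈ y → P x → P y) → (∀ x → Dec (P x)) → Dec (Σ A P)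

searchFin : ∀ n → Searchable (Fin n) _≡_
searchFin n _ = FinP.any?

searchBool : Searchable Bool _≡_
searchBool _ P? with P? true | P? false
... | yes p | _     = yes (true , p)
... | no  _ | yes p = yes (false , p)
... | no ¬t | no ¬f = no λ { (true , p) → ¬t p ; (false , p) → ¬f p }

-- Without function extensionality a search reaches functions only up to pointwise equality.
-- Predicates must therefore respect this relation, and `Searchable` carries a relation for that
-- reason.
searchFun : ∀ {A : Set} {_≈_ : A → A → Set} → (∀ {a} → a ≈ a) → Searchable A _≈_ →
  ∀ n → Searchable (Fin n → A) (λ f g → ∀ i → f i ≈ g i)
searchFun r sA zero resp P? = map′ (λ p → _ , p) (λ (f , p) → resp (λ ()) p) (P? (λ ()))
searchFun r sA (suc n) {P} resp P? =
  map′ (λ (a , f , p) → a ∷ᵛ f , p)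
       (λ (f , p) → f zero , f ∘ suc , resp (λ { zero → r ; (suc _) → r }) p)
       (sA (λ e (f , p) → f , resp (λ { zero → e ; (suc _) → r }) p)
           (λ a → searchFun r sA n (λ e → resp (λ { zero → r ; (suc i) → e i })) (λ f → P? (a ∷ᵛ f))))

↑ˡ≢↑ʳ : ∀ {k l} {i : Fin k} {j : Fin l} → i ↑ˡ l ≢ k ↑ʳ j
↑ˡ≢↑ʳ {k} {l} {i} {j} p with () ← trans (sym (FinP.splitAt-↑ˡ k i l)) (trans (cong (splitAt k) p) (FinP.splitAt-↑ʳ k l j))

==F-refl : ∀ {n} (a : Fin n) → (a ==F a) ≡ true
==F-refl a = dec-true (a Fin.≟ a) refl

==F-neq : ∀ {n} {a b : Fin n} → a ≢ b → (a ==F b) ≡ false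
==F-neq {a = a} {b} = dec-false (a Fin.≟ b)

==F-sound : ∀ {n} (a b : Fin n) → (a ==F b) ≡ true → a ≡ b
==F-sound a b e with a Fin.≟ b
... | yes p = p
==F-sound a b () | no _

module _ {s : Sig} where

  any-elab? : ∀ {P : ELab s → Set} → (∀ γ → Dec (P γ)) → Dec (Σ (ELab s) P)
  any-elab? P? = map′ (λ { (inj₁ (i , p)) → enc i , p ; (inj₂ (i , p)) → plain i , p })
                      (λ { (enc i , p) → inj₁ (i , p) ; (plain i , p) → inj₂ (i , p) })
                      (FinP.any? (P? ∘ enc) ⊎-dec FinP.any? (P? ∘ plain))

  all-elab? : ∀ {P : ELab s → Set} → (∀ γ → Dec (P γ)) → Dec (∀ γ → P γ)
  all-elab? P? = map′ (λ { (p , q) (enc i) → p i ; (p , q) (plain i) → q i })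
                      (λ p → p ∘ enc , p ∘ plain)
                      (FinP.all? (P? ∘ enc) ×-dec FinP.all? (P? ∘ plain))

  searchLab : Searchable (Lab s) _≡_
  searchLab _ P? =
    map′ (λ { (inj₁ (i , p)) → node i , p ; (inj₂ (inj₁ (i , p))) → wire i , p ; (inj₂ (inj₂ (i , p))) → nt i , p })
         (λ { (node i , p) → inj₁ (i , p) ; (wire i , p) → inj₂ (inj₁ (i , p)) ; (nt i , p) → inj₂ (inj₂ (i , p)) })
         (FinP.any? (P? ∘ node) ⊎-dec (FinP.any? (P? ∘ wire) ⊎-dec FinP.any? (P? ∘ nt)))

  searchELabPred : Searchable (ELab s → Bool) (λ f g → ∀ γ → f γ ≡ g γ)
  searchELabPred {P} resp P? =
    map′ (λ (f , g , p) → [ f ∣ g ] , p)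
         (λ (h , p) → h ∘ enc , h ∘ plain , resp (λ { (enc _) → refl ; (plain _) → refl }) p)
         (searchFun refl searchBool _ {λ f → Σ _ λ g → P [ f ∣ g ]}
            (λ e (g , p) → g , resp (λ { (enc i) → e i ; (plain _) → refl }) p)
            (λ f → searchFun refl searchBool _ {λ g → P [ f ∣ g ]}
               (λ e → resp (λ { (enc i) → refl ; (plain i) → e i })) (λ g → P? [ f ∣ g ])))
    where
    [_∣_] : (Fin (Sig.nEnc s) → Bool) → (Fin (Sig.nPlain s) → Bool) → ELab s → Bool
    [ f ∣ g ] (enc i)   = f i
    [ f ∣ g ] (plain i) = g i

  ==E-sound : ∀ (γ δ : ELab s) → (γ ==E δ) ≡ true → γ ≡ δ
  ==E-sound (enc a) (enc b) e = cong enc (==F-sound a b e)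
  ==E-sound (plain a) (plain b) e = cong plain (==F-sound a b e)
  ==E-sound (enc a) (plain b) ()
  ==E-sound (plain a) (enc b) ()

  ==E-refl : ∀ (γ : ELab s) → (γ ==E γ) ≡ true
  ==E-refl (enc a) = ==F-refl a
  ==E-refl (plain a) = ==F-refl a

  ==L-sound : ∀ (a b : Lab s) → (a ==L b) ≡ true → a ≡ b
  ==L-sound (node a) (node b) e = cong node (==F-sound a b e)
  ==L-sound (wire a) (wire b) e = cong wire (==F-sound a b e)
  ==L-sound (nt a) (nt b) e = cong nt (==F-sound a b e)
  ==L-sound (node a) (wire b) ()
  ==L-sound (node a) (nt b) ()
  ==L-sound (wire a) (node b) ()
  ==L-sound (wire a) (nt b) ()
  ==L-sound (nt a) (node b) ()
  ==L-sound (nt a) (wire b) ()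

  ==L-refl : ∀ (a : Lab s) → (a ==L a) ≡ true
  ==L-refl (node a) = ==F-refl a
  ==L-refl (wire a) = ==F-refl a
  ==L-refl (nt a) = ==F-refl a

  _≟L_ : (a b : Lab s) → Dec (a ≡ b)
  a ≟L b = map′ (==L-sound a b) (λ { refl → ==L-refl a }) ((a ==L b) Bool.≟ true)

  _≟E_ : (a b : ELab s) → Dec (a ≡ b)
  a ≟E b = map′ (==E-sound a b) (λ { refl → ==E-refl a }) ((a ==E b) Bool.≟ true)

  node≢wire : ∀ {l : Lab s} → isNode l ≡ true → isWire l ≡ true → ⊥
  node≢wire {node _} _ ()

  isWire? : (l : Lab s) → Dec (isWire l ≡ true)
  isWire? l = isWire l Bool.≟ true

-- Wire-homeomorphism

module _ {s : Sig} where

  SameWire : (G : Graph s) → Fin (n G) → Fin (n G) → Set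
  SameWire G a b = isWire (lab G a) ≡ true × lab G a ≡ lab G b

  sameWire? : ∀ (G : Graph s) a b → Dec (SameWire G a b)
  sameWire? G a b = isWire? (lab G a) ×-dec (lab G a ≟L lab G b)

  -- A splitting copies the label of the vertex, so these are the only edges that can be created or
  -- contracted, and their own labels are arbitrary. An edge between differently labelled
  -- wire-vertices is as rigid as one at a node-vertex.
  Inner : (G : Graph s) → Fin (n G) → Fin (n G) → Set
  Inner G a b = SameWire G a b × Σ (ELab s) λ γ → edge G a b γ ≡ true

  inner? : ∀ (G : Graph s) a b → Dec (Inner G a b)
  inner? G a b = sameWire? G a b ×-dec any-elab? (λ γ → edge G a b γ Bool.≟ true)

  Same : (G : Graph s) → Fin (n G) → Fin (n G) → Set
  Same G = EqClosure (Inner G)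

  Head : (G : Graph s) → Fin (n G) → Set
  Head G h = ∀ a → ¬ Inner G a h

  Headed : (G : Graph s) → Fin (n G) → Set
  Headed G v = Σ (Fin (n G)) λ h → Same G v h × Head G h

  -- A splitting hands outgoing edges over to the new vertex, so `proper` can keep the ends of an
  -- edge only up to `Same`. Passing to classes would not show whether a wire is open or closed;
  -- `headed` retains this.
  record Mor (G H : Graph s) : Set where
    field
      f : Fin (n G) → Fin (n H)
      labEq  : ∀ a → lab H (f a) ≡ lab G a
      same   : ∀ {a b} → Inner G a b → Same H (f a) (f b)
      proper : ∀ a b γ → ¬ SameWire G a b → edge G a b γ ≡ true →
        Σ (Fin (n H)) λ a' → Σ (Fin (n H)) λ b' → Same H (f a) a' × Same H (f b) b' × edge H a' b' γ ≡ true
      headed : ∀ h → Head G h → Headed H (f h)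

    same* : ∀ {a b} → Same G a b → Same H (f a) (f b)
    same* ε = ε
    same* (Sym.fwd e ◅ p) = same e ◅◅ same* p
    same* (Sym.bwd e ◅ p) = Eq.symmetric _ (same e) ◅◅ same* p

  same-lab : ∀ (G : Graph s) {a b} → Same G a b → lab G a ≡ lab G b
  same-lab G ε = refl
  same-lab G (Sym.fwd ((_ , e) , _) ◅ p) = trans e (same-lab G p)
  same-lab G (Sym.bwd ((_ , e) , _) ◅ p) = trans (sym e) (same-lab G p)

  sameWire-cong : ∀ {G H : Graph s} {a b c d} → lab H c ≡ lab G a → lab H d ≡ lab G b →
    SameWire H c d → SameWire G a b
  sameWire-cong e f (w , l) = trans (cong isWire (sym e)) w , trans (sym e) (trans l f)

  idMor : ∀ G → Mor G G
  idMor G = record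
    { f = id ; labEq = λ _ → refl ; same = Eq.return
    ; proper = λ a b γ _ e → a , b , ε , ε , e ; headed = λ h hd → h , ε , hd }

  _∙_ : ∀ {G H K} → Mor G H → Mor H K → Mor G K
  _∙_ {G} {H} {K} p q = record
    { f = q.f ∘ p.f
    ; labEq = λ a → trans (q.labEq (p.f a)) (p.labEq a)
    ; same = λ i → q.same* (p.same i)
    ; proper = λ a b γ ns e →
        let a₁ , b₁ , sa , sb , e₁ = p.proper a b γ ns e
            la = trans (sym (same-lab H sa)) (p.labEq a)
            lb = trans (sym (same-lab H sb)) (p.labEq b)
            a₂ , b₂ , sa₂ , sb₂ , e₂ = q.proper a₁ b₁ γ (ns ∘ sameWire-cong {G} {H} la lb) e₁
        in a₂ , b₂ , q.same* sa ◅◅ sa₂ , q.same* sb ◅◅ sb₂ , e₂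
    ; headed = λ h hd →
        let h₁ , s₁ , hd₁ = p.headed h hd
            h₂ , s₂ , hd₂ = q.headed h₁ hd₁
        in h₂ , q.same* s₁ ◅◅ s₂ , hd₂
    }
    where
    module p = Mor p
    module q = Mor q

  record Corr (G H : Graph s) : Set where
    field
      to   : Mor G H
      from : Mor H G
      from∘to : ∀ a → Same G (Mor.f from (Mor.f to a)) a
      to∘from : ∀ b → Same H (Mor.f to (Mor.f from b)) b

  corr-refl : ∀ {G} → Corr G G
  corr-refl {G} = record { to = idMor G ; from = idMor G ; from∘to = λ _ → ε ; to∘from = λ _ → ε }

  corr-sym : ∀ {G H} → Corr G H → Corr H G
  corr-sym c = record { to = from ; from = to ; from∘to = to∘from ; to∘from = from∘to }
    where open Corr c

  corr-trans : ∀ {G H K} → Corr G H → Corr H K → Corr G K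
  corr-trans c d = record
    { to = C.to ∙ D.to ; from = D.from ∙ C.from
    ; from∘to = λ a → Mor.same* C.from (D.from∘to _) ◅◅ C.from∘to a
    ; to∘from = λ b → Mor.same* D.to (C.to∘from _) ◅◅ D.to∘from b }
    where
    module C = Corr c
    module D = Corr d

  module _ (G : Graph s) (v : Fin (n G)) (γ : ELab s) (wv : isWire (lab G v) ≡ true) where
    private
      G' = splitGraph G v γ

      back : Fin (suc (n G)) → Fin (n G)
      back zero = v
      back (suc a) = a

      v→v' : Inner G' (suc v) zero
      v→v' = (wv , refl) , γ , cong₂ _∧_ (==F-refl v) (==E-refl γ)

      kept : ∀ {a} b δ → a ≢ v → edge G' (suc a) (suc b) δ ≡ edge G a b δ
      kept b δ ne = cong (λ x → not x ∧ edge G _ b δ) (==F-neq ne)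

      innerG : ∀ {a b} → Inner G' (suc a) (suc b) → Inner G a b
      innerG {a} {b} (sw , δ , e) = sw , δ , BoolP.∧-conicalʳ (not (a ==F v)) _ e

      to : Mor G G'
      to = record { f = suc ; labEq = λ _ → refl ; same = same ; proper = proper ; headed = λ h hd → suc h , ε , head h hd }
        where
        same : ∀ {a b} → Inner G a b → Same G' (suc a) (suc b)
        same {a} {b} (sw , δ , e) with a Fin.≟ v
        -- Edges leaving `v` now start at the new vertex, so one inner edge becomes a path of two.
        ... | yes refl = _◅_ {j = zero} (Sym.fwd v→v') (Sym.fwd (sw , δ , e) ◅ ε)
        ... | no ne = Sym.fwd (sw , δ , trans (kept b δ ne) e) ◅ ε
        proper : ∀ a b δ → ¬ SameWire G a b → edge G a b δ ≡ true →
          Σ (Fin (suc (n G))) λ a' → Σ (Fin (suc (n G))) λ b' →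
            Same G' (suc a) a' × Same G' (suc b) b' × edge G' a' b' δ ≡ true
        proper a b δ _ e with a Fin.≟ v
        ... | yes refl = zero , suc b , Sym.fwd v→v' ◅ ε , ε , e
        ... | no ne = suc a , suc b , ε , ε , trans (kept b δ ne) e
        head : ∀ h → Head G h → Head G' (suc h)
        head h hd zero (sw , δ , e) = hd v (sw , δ , e)
        head h hd (suc a) i = hd a (innerG i)

      from : Mor G' G
      from = record { f = back ; labEq = labEq ; same = λ {a} {b} → same a b ; proper = proper ; headed = headed }
        where
        labEq : ∀ a → lab G (back a) ≡ lab G' a
        labEq zero = refl
        labEq (suc a) = refl
        same : ∀ a b → Inner G' a b → Same G (back a) (back b)
        same zero zero (_ , _ , ())
        same zero (suc b) i = Sym.fwd i ◅ ε
        same (suc a) zero (_ , δ , e) with refl ← ==F-sound a v (BoolP.∧-conicalˡ _ _ e) = ε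
        same (suc a) (suc b) i = Sym.fwd (innerG i) ◅ ε
        proper : ∀ a b δ → ¬ SameWire G' a b → edge G' a b δ ≡ true →
          Σ (Fin (n G)) λ a' → Σ (Fin (n G)) λ b' →
            Same G (back a) a' × Same G (back b) b' × edge G a' b' δ ≡ true
        proper zero zero δ ns ()
        proper zero (suc b) δ ns e = v , b , ε , ε , e
        proper (suc a) zero δ ns e with refl ← ==F-sound a v (BoolP.∧-conicalˡ _ _ e) = ⊥-elim (ns (wv , refl))
        proper (suc a) (suc b) δ ns e = a , b , ε , ε , BoolP.∧-conicalʳ (not (a ==F v)) _ e
        headed : ∀ h → Head G' h → Headed G (back h)
        headed zero hd = ⊥-elim (hd (suc v) v→v')
        headed (suc h) hd = h , ε , λ a (sw , δ , e) → case a Fin.≟ v of λ where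
          (yes refl) → hd zero (sw , δ , e)
          (no ne) → hd (suc a) (sw , δ , trans (kept h δ ne) e)

    corr-split : Corr G G'
    corr-split = record { to = to ; from = from ; from∘to = λ _ → ε
                        ; to∘from = λ { zero → Sym.fwd v→v' ◅ ε ; (suc b) → ε } }

  iso-sym : ∀ {G H : Graph s} → Iso G H → Iso H G
  iso-sym {G} {H} i = record
    { to = from ; from = to ; from∘to = to∘from ; to∘from = from∘to
    ; labPres = λ a → trans (sym (labPres (from a))) (cong (lab H) (to∘from a))
    ; edgePres = λ a b γ → trans (sym (edgePres (from a) (from b) γ))
                                 (cong₂ (λ x y → edge H x y γ) (to∘from a) (to∘from b)) }
    where open Iso i

  mor-iso : ∀ {G H : Graph s} → Iso G H → Mor G H
  mor-iso {G} {H} i = record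
    { f = to ; labEq = labPres
    ; same = λ {a} {b} (sw , γ , e) →
        Eq.return (sameWire-cong {H} {G} (sym (labPres a)) (sym (labPres b)) sw , γ , trans (edgePres a b γ) e)
    ; proper = λ a b γ _ e → to a , to b , ε , ε , trans (edgePres a b γ) e
    ; headed = λ h hd → to h , ε , λ a (sw , γ , e) →
        hd (from a) ( sameWire-cong {G} {H} (trans (cong (lab H) (sym (to∘from a))) (labPres (from a))) (labPres h) sw
                    , γ , trans (sym (edgePres (from a) h γ)) (trans (cong (λ x → edge H x (to h) γ) (to∘from a)) e)) }
    where open Iso i

  corr-iso : ∀ {G H : Graph s} → Iso G H → Corr G H
  corr-iso {G} {H} i = record
    { to = mor-iso i ; from = mor-iso (iso-sym i)
    ; from∘to = λ a → subst (Same G _) (from∘to a) ε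
    ; to∘from = λ b → subst (Same H _) (to∘from b) ε }
    where open Iso i

  corr-step : ∀ {G H : Graph s} → WStep G H → Corr G H
  corr-step (splitS (split v γ w)) = corr-split _ v γ w
  corr-step (isoS i) = corr-iso i

  wireHom⇒corr : ∀ {G H : Graph s} → WireHom G H → Corr G H
  wireHom⇒corr ε = corr-refl
  wireHom⇒corr (Sym.fwd st ◅ p) = corr-trans (corr-step st) (wireHom⇒corr p)
  wireHom⇒corr (Sym.bwd st ◅ p) = corr-trans (corr-sym (corr-step st)) (wireHom⇒corr p)

bool-ext : ∀ {a b : Bool} → (a ≡ true → b ≡ true) → (b ≡ true → a ≡ true) → a ≡ b
bool-ext {true}  f g = sym (f refl)
bool-ext {false} {true}  f g = g refl
bool-ext {false} {false} f g = refl

-- Merging two adjacent wire-vertices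

module _ {s : Sig} where

  -- This survives every merge, whereas merging a wire closed up to two vertices creates a loop and
  -- so destroys `IsStringGraph`.
  WireDeg≤1 : Graph s → Set
  WireDeg≤1 G = ∀ v → isWire (lab G v) ≡ true → InDeg≤1 G v × OutDeg≤1 G v

  -- The vertex `v'` disappears and `v` remains. Giving `v` by its index `v₀` among the remaining
  -- vertices builds in `v ≢ v'` and makes `Fin m` the new vertex set.
  module MergeWires {m} (l : Fin (suc m) → Lab s) (e : Fin (suc m) → Fin (suc m) → ELab s → Bool)
    (v' : Fin (suc m)) (v₀ : Fin m) (γ : ELab s) where

    G : Graph s
    G = record { n = suc m ; lab = l ; edge = e }

    ι : Fin m → Fin (suc m)
    ι = punchIn v'

    v : Fin (suc m)
    v = ι v₀

    -- the vertex of G whose outgoing edges the vertex a of the merged graph inherits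
    src : Fin m → Fin (suc m)
    src a with a Fin.≟ v₀
    ... | yes _ = v'
    ... | no  _ = ι a

    merged : Graph s
    merged = record { n = m ; lab = λ a → l (ι a) ; edge = λ a b δ → e (src a) (ι b) δ }

    q : Fin (suc m) → Fin m
    q u with v' Fin.≟ u
    ... | yes _ = v₀
    ... | no ne = punchOut ne

    ι≢v' : ∀ {a} → ι a ≢ v'
    ι≢v' = FinP.punchInᵢ≢i v' _

    src-v₀ : src v₀ ≡ v'
    src-v₀ with v₀ Fin.≟ v₀
    ... | yes _ = refl
    ... | no ne = ⊥-elim (ne refl)

    src-≢ : ∀ {a} → a ≢ v₀ → src a ≡ ι a
    src-≢ {a} ne with a Fin.≟ v₀
    ... | yes p = ⊥-elim (ne p)
    ... | no _  = refl

    q-v' : q v' ≡ v₀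
    q-v' with v' Fin.≟ v'
    ... | yes _ = refl
    ... | no ne = ⊥-elim (ne refl)

    ι-q : ∀ {u} → u ≢ v' → ι (q u) ≡ u
    ι-q {u} ne with v' Fin.≟ u
    ... | yes p = ⊥-elim (ne (sym p))
    ... | no p  = FinP.punchIn-punchOut p

    q-ι : ∀ a → q (ι a) ≡ a
    q-ι a = FinP.punchIn-injective v' _ _ (ι-q ι≢v')

    src-q : ∀ {u} → u ≢ v → src (q u) ≡ u
    src-q {u} ne with u Fin.≟ v'
    ... | yes refl = trans (cong src q-v') src-v₀
    ... | no ne'   = trans (src-≢ λ p → ne (trans (sym (ι-q ne')) (cong ι p))) (ι-q ne')

    q-src : ∀ a → q (src a) ≡ a
    q-src a with a Fin.≟ v₀
    ... | yes refl = q-v'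
    ... | no _     = q-ι a

    module _ (sw : SameWire G v v') (evv' : e v v' γ ≡ true) (wd : WireDeg≤1 G) where

      private
        wv' : isWire (l v') ≡ true
        wv' = trans (cong isWire (sym (proj₂ sw))) (proj₁ sw)

        from-v : ∀ {y δ} → e v y δ ≡ true → v' ≡ y × γ ≡ δ
        from-v = proj₂ (wd v (proj₁ sw)) _ _ _ _ evv'

        to-v' : ∀ {x δ} → e x v' δ ≡ true → v ≡ x × γ ≡ δ
        to-v' = proj₁ (wd v' wv') _ _ _ _ evv'

      lab-src : ∀ a → l (src a) ≡ l (ι a)
      lab-src a with a Fin.≟ v₀
      ... | yes refl = sym (proj₂ sw)
      ... | no _     = refl

      lab-q : ∀ u → l (ι (q u)) ≡ l u
      lab-q u with u Fin.≟ v'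
      ... | yes refl = trans (cong (l ∘ ι) q-v') (proj₂ sw)
      ... | no ne    = cong l (ι-q ne)

      merged-deg : WireDeg≤1 merged
      merged-deg a w =
        (λ b c δ ε eb ec → let p , p' = proj₁ (wd (ι a) w) _ _ _ _ eb ec
                           in trans (sym (q-src b)) (trans (cong q p) (q-src c)) , p') ,
        (λ b c δ ε eb ec → let p , p' = proj₂ (wd (src a) (trans (cong isWire (lab-src a)) w)) _ _ _ _ eb ec
                           in FinP.punchIn-injective v' _ _ p , p')

      -- By the degree bounds `v → v'` is the only edge out of `v` and the only edge into `v'`. It
      -- is thus the only edge lost in the merge, and splitting with its label `γ` restores it.
      merge-iso : Iso (splitGraph merged v₀ γ) G
      merge-iso = record { to = to ; from = from ; from∘to = from∘to ; to∘from = to∘from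
                         ; labPres = labPres ; edgePres = edgePres }
        where
        to : Fin (suc m) → Fin (suc m)
        to zero = v'
        to (suc a) = ι a
        from : Fin (suc m) → Fin (suc m)
        from u with u Fin.≟ v'
        ... | yes _ = zero
        ... | no _  = suc (q u)
        from∘to : ∀ a → from (to a) ≡ a
        from∘to zero with v' Fin.≟ v'
        ... | yes _ = refl
        ... | no ne = ⊥-elim (ne refl)
        from∘to (suc a) with ι a Fin.≟ v'
        ... | yes p = ⊥-elim (ι≢v' p)
        ... | no _  = cong suc (q-ι a)
        to∘from : ∀ b → to (from b) ≡ b
        to∘from b with b Fin.≟ v'
        ... | yes p = sym p
        ... | no ne = ι-q ne
        labPres : ∀ a → l (to a) ≡ lab (splitGraph merged v₀ γ) a
        labPres zero = sym (proj₂ sw)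
        labPres (suc a) = refl
        edgePres : ∀ a b δ → e (to a) (to b) δ ≡ edge (splitGraph merged v₀ γ) a b δ
        edgePres zero zero δ = BoolP.¬-not (λ x → ι≢v' (proj₁ (to-v' x)))
        edgePres zero (suc b) δ = cong (λ x → e x (ι b) δ) (sym src-v₀)
        edgePres (suc a) zero δ = bool-ext
          (λ x → let p , p' = to-v' x in
             cong₂ _∧_ (trans (cong (_==F v₀) (sym (FinP.punchIn-injective v' _ _ p))) (==F-refl v₀))
                       (trans (cong (_==E γ) (sym p')) (==E-refl γ)))
          (λ x → let p = ==F-sound a v₀ (BoolP.∧-conicalˡ _ _ x)
                     p' = ==E-sound δ γ (BoolP.∧-conicalʳ (a ==F v₀) _ x)
                 in trans (cong₂ (λ a δ → e (ι a) v' δ) p p') evv')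
        edgePres (suc a) (suc b) δ with a Fin.≟ v₀
        ... | yes refl = BoolP.¬-not (λ x → ι≢v' (sym (proj₁ (from-v x))))
        ... | no ne    = refl

      merge-wireHom : WireHom G merged
      merge-wireHom = Sym.bwd (isoS merge-iso) ◅ Sym.bwd (splitS (split v₀ γ (proj₁ sw))) ◅ ε

      merged-string : IsStringGraph G → (∀ δ → e v' v δ ≡ false) → IsStringGraph merged
      merged-string sg acyc = record
        { loopless = loop
        ; terminal = λ a → S.terminal (ι a)
        ; noNodeNode = λ a b δ na nb → S.noNodeNode _ _ δ (trans (cong isNode (lab-src a)) na) nb
        ; wireIn = λ a w → proj₁ (merged-deg a w)
        ; wireOut = λ a w → proj₂ (merged-deg a w) }
        where
        module S = IsStringGraph sg
        loop : ∀ a δ → e (src a) (ι a) δ ≡ false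
        loop a δ with a Fin.≟ v₀
        ... | yes refl = acyc δ
        ... | no _     = S.loopless (ι a) δ

      -- If just one of `v` and `v'` is matched, the edge between them already leaves the image. The
      -- matched one is therefore a boundary vertex of `K` and may inherit further edges to the
      -- outside.
      merged-matching : ∀ {K} (M : Matching K G) →
        ¬ (Σ (Fin (n K)) (λ c → Matching.m M c ≡ v) × Σ (Fin (n K)) (λ c → Matching.m M c ≡ v')) →
        Matching K merged
      merged-matching {K} M notBoth = record
        { m = λ c → q (μ c)
        ; injective = inj
        ; labPres = λ a → trans (lab-q (μ a)) (M.labPres a)
        ; edgePres = λ a b δ x → pres a b δ (M.edgePres a b δ x)
        ; boundaryOut = bOut
        ; boundaryIn = bIn }
        where
        module M = Matching M
        μ = M.m
        inj : ∀ a b → q (μ a) ≡ q (μ b) → a ≡ b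
        inj a b p with μ a Fin.≟ v' | μ b Fin.≟ v'
        ... | yes pa | yes pb = M.injective a b (trans pa (sym pb))
        ... | yes pa | no nb  = ⊥-elim (notBoth ((b , trans (sym (ι-q nb)) (cong ι (trans (sym p) (trans (cong q pa) q-v')))) , a , pa))
        ... | no na  | yes pb = ⊥-elim (notBoth ((a , trans (sym (ι-q na)) (cong ι (trans p (trans (cong q pb) q-v')))) , b , pb))
        ... | no na  | no nb  = M.injective a b (trans (sym (ι-q na)) (trans (cong ι p) (ι-q nb)))
        pres : ∀ a b δ → e (μ a) (μ b) δ ≡ true → e (src (q (μ a))) (ι (q (μ b))) δ ≡ true
        pres a b δ x with μ a Fin.≟ v | μ b Fin.≟ v'
        ... | yes pa | _ = ⊥-elim (notBoth ((a , pa) , b , sym (proj₁ (from-v (trans (cong (λ z → e z (μ b) δ) (sym pa)) x)))))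
        ... | no na | yes pb = ⊥-elim (na (sym (proj₁ (to-v' (trans (cong (λ z → e (μ a) z δ) (sym pb)) x)))))
        ... | no na | no nb = trans (cong₂ (λ y z → e y z δ) (src-q na) (ι-q nb)) x
        bOut : ∀ a b δ → e (src (q (μ a))) (ι b) δ ≡ true → (∀ c → q (μ c) ≢ b) → IsBoundary K a
        bOut a b δ x out with μ a Fin.≟ v
        ... | yes pa = M.boundaryOut a v' γ (trans (cong (λ z → e z v' γ) pa) evv') (λ c pc → notBoth ((a , pa) , c , pc))
        ... | no na = M.boundaryOut a (ι b) δ (trans (cong (λ z → e z (ι b) δ) (sym (src-q na))) x)
                        (λ c pc → out c (trans (cong q pc) (q-ι b)))
        bIn : ∀ a b δ → e (src b) (ι (q (μ a))) δ ≡ true → (∀ c → q (μ c) ≢ b) → IsBoundary K a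
        bIn a b δ x out with μ a Fin.≟ v'
        ... | yes pa = M.boundaryIn a v γ (trans (cong (λ z → e v z γ) pa) evv') (λ c pc → notBoth ((c , pc) , a , pa))
        ... | no na = M.boundaryIn a (src b) δ (trans (cong (λ z → e (src b) z δ) (sym (ι-q na))) x)
                        (λ c pc → out c (trans (cong q pc) (q-src b)))

-- Exchanging the labels of loops

module _ {s : Sig} where

  graphOn : ∀ {k} → (Fin k → Lab s) → (Fin k → Fin k → ELab s → Bool) → Graph s
  graphOn l e = record { n = _ ; lab = l ; edge = e }

  iso-pointwise : ∀ {k} {l l' : Fin k → Lab s} {e e' : Fin k → Fin k → ELab s → Bool} →
    (∀ a → l' a ≡ l a) → (∀ a b γ → e' a b γ ≡ e a b γ) →
    Iso (graphOn l e) (graphOn l' e')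
  iso-pointwise eqₗ eqₑ = record
    { to = id ; from = id ; from∘to = λ _ → refl ; to∘from = λ _ → refl ; labPres = eqₗ ; edgePres = eqₑ }

  -- Splitting the loop with the label `δ'` gives a wire closed up to two vertices, with edges
  -- labelled `δ'` and `δ`. Contracting the `δ`-edge instead of the `δ'`-edge leaves a loop labelled
  -- `δ'`; the isomorphism `swap` exchanges the two vertices.
  relabel-loop : ∀ {k} (l : Fin k → Lab s) (e e' : Fin k → Fin k → ELab s → Bool) v δ δ' →
    isWire (l v) ≡ true →
    (∀ γ → e v v γ ≡ (γ ==E δ)) → (∀ γ → e' v v γ ≡ (γ ==E δ')) →
    (∀ b γ → b ≢ v → e v b γ ≡ false × e b v γ ≡ false) →
    (∀ a b γ → ¬ (a ≡ v × b ≡ v) → e' a b γ ≡ e a b γ) →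
    WireHom (graphOn l e) (graphOn l e')
  relabel-loop {k} l e e' v δ δ' wv loop loop' isolated agree =
    Sym.fwd (splitS (split v δ' wv)) ◅ Sym.fwd (isoS swap) ◅ Sym.bwd (splitS (split v δ wv)) ◅ ε
    where
    G G' : Graph s
    G  = graphOn l e
    G' = graphOn l e'

    τ : Fin (suc k) → Fin (suc k)
    τ zero = suc v
    τ (suc a) with a Fin.≟ v
    ... | yes _ = zero
    ... | no _  = suc a

    ττ : ∀ a → τ (τ a) ≡ a
    ττ zero with v Fin.≟ v
    ... | yes _ = refl
    ... | no ne = ⊥-elim (ne refl)
    ττ (suc a) with a Fin.≟ v
    ... | yes refl = refl
    ... | no ne with a Fin.≟ v
    ...   | yes p = ⊥-elim (ne p)
    ...   | no _  = refl

    labτ : ∀ a → lab (splitGraph G' v δ) (τ a) ≡ lab (splitGraph G v δ') a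
    labτ zero = refl
    labτ (suc a) with a Fin.≟ v
    ... | yes refl = refl
    ... | no _     = refl

    edgeτ : ∀ a b γ → edge (splitGraph G' v δ) (τ a) (τ b) γ ≡ edge (splitGraph G v δ') a b γ
    edgeτ zero zero γ = cong (λ x → not x ∧ e' v v γ) (==F-refl v)
    edgeτ zero (suc b) γ with b Fin.≟ v
    ... | yes refl = trans (cong (_∧ (γ ==E δ)) (==F-refl v)) (sym (loop γ))
    ... | no ne    = trans (cong (λ x → not x ∧ e' v b γ) (==F-refl v)) (sym (proj₁ (isolated b γ ne)))
    edgeτ (suc a) zero γ with a Fin.≟ v
    ... | yes refl = loop' γ
    ... | no ne    = trans (cong (λ x → not x ∧ e' a v γ) (==F-neq ne))
                           (trans (agree a v γ (ne ∘ proj₁)) (proj₂ (isolated a γ ne)))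
    edgeτ (suc a) (suc b) γ with a Fin.≟ v | b Fin.≟ v
    ... | yes refl | yes refl = refl
    ... | yes refl | no nb = trans (agree v b γ (nb ∘ proj₂)) (proj₁ (isolated b γ nb))
    ... | no na | yes refl = trans (cong (_∧ (γ ==E δ)) (==F-neq na)) (sym (proj₂ (isolated a γ na)))
    ... | no na | no nb = trans (cong (λ x → not x ∧ e' a b γ) (==F-neq na)) (agree a b γ (na ∘ proj₁))

    swap : Iso (splitGraph G v δ') (splitGraph G' v δ)
    swap = record { to = τ ; from = τ ; from∘to = ττ ; to∘from = ττ ; labPres = labτ ; edgePres = edgeτ }

  module RelabelLoops {k} (l : Fin k → Lab s) (e e' : Fin k → Fin k → ELab s → Bool)
    (deg : WireDeg≤1 (graphOn l e))
    (deg' : WireDeg≤1 (graphOn l e'))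
    (off : ∀ a b γ → ¬ (a ≡ b × isWire (l a) ≡ true) → e' a b γ ≡ e a b γ)
    (on : ∀ a → isWire (l a) ≡ true → (Σ (ELab s) λ γ → e a a γ ≡ true) → Σ (ELab s) λ γ → e' a a γ ≡ true)
    (on' : ∀ a → isWire (l a) ≡ true → (Σ (ELab s) λ γ → e' a a γ ≡ true) → Σ (ELab s) λ γ → e a a γ ≡ true)
    where

    -- Interpolates between `e` and `e'`: consecutive stages differ in at most one loop, so
    -- `relabel-loop` applies at each stage.
    mixed : ℕ → Fin k → Fin k → ELab s → Bool
    mixed j a b γ with a Fin.≟ b | toℕ a ℕ.<? j
    ... | yes _ | yes _ = e' a b γ
    ... | _     | _     = e a b γ

    private
      graph : (Fin k → Fin k → ELab s → Bool) → Graph s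
      graph = graphOn l

      mixed-off : ∀ j a b γ → a ≢ b → mixed j a b γ ≡ e a b γ
      mixed-off j a b γ ne with a Fin.≟ b | toℕ a ℕ.<? j
      ... | yes p | _     = ⊥-elim (ne p)
      ... | no _  | yes _ = refl
      ... | no _  | no _  = refl

      mixed-< : ∀ j a γ → toℕ a < j → mixed j a a γ ≡ e' a a γ
      mixed-< j a γ lt with a Fin.≟ a | toℕ a ℕ.<? j
      ... | yes _ | yes _ = refl
      ... | yes _ | no nl = ⊥-elim (nl lt)
      ... | no ne | _     = ⊥-elim (ne refl)

      mixed-≥ : ∀ j a γ → ¬ toℕ a < j → mixed j a a γ ≡ e a a γ
      mixed-≥ j a γ ge with a Fin.≟ a | toℕ a ℕ.<? j
      ... | yes _ | yes lt = ⊥-elim (ge lt)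
      ... | yes _ | no _   = refl
      ... | no _  | yes _  = refl
      ... | no _  | no _   = refl

      mixed-other : ∀ j a b γ → ¬ (toℕ a ≡ j × a ≡ b) → mixed (suc j) a b γ ≡ mixed j a b γ
      mixed-other j a b γ ne = by-cases (a Fin.≟ b) (toℕ a ℕ.<? j)
        where
        by-cases : Dec (a ≡ b) → Dec (toℕ a < j) → mixed (suc j) a b γ ≡ mixed j a b γ
        by-cases (no p) _ = trans (mixed-off (suc j) a b γ p) (sym (mixed-off j a b γ p))
        by-cases (yes refl) (yes lt) = trans (mixed-< (suc j) a γ (ℕₚ.m<n⇒m<1+n lt)) (sym (mixed-< j a γ lt))
        by-cases (yes refl) (no ge) =
          trans (mixed-≥ (suc j) a γ (λ lt → ne (ℕₚ.≤-antisym (ℕ.s≤s⁻¹ lt) (ℕₚ.≮⇒≥ ge) , refl))) (sym (mixed-≥ j a γ ge))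

      isolated : ∀ {f} → WireDeg≤1 (graph f) → ∀ v δ → isWire (l v) ≡ true → f v v δ ≡ true →
        (∀ γ → f v v γ ≡ (γ ==E δ)) × (∀ b γ → b ≢ v → f v b γ ≡ false × f b v γ ≡ false)
      isolated {f} d v δ w p =
        (λ γ → bool-ext (λ x → trans (cong (γ ==E_) (proj₂ (proj₁ (d v w) _ _ _ _ p x))) (==E-refl γ))
                        (λ x → trans (cong (f v v) (==E-sound γ δ x)) p)) ,
        (λ b γ ne → BoolP.¬-not (λ x → ne (proj₁ (proj₂ (d v w) _ _ _ _ x p))) ,
                    BoolP.¬-not (λ x → ne (proj₁ (proj₁ (d v w) _ _ _ _ x p))))

      step : ∀ j → j < k → WireHom (graph (mixed j)) (graph (mixed (suc j)))
      step j j<k = by-cases (isWire? (l v)) (any-elab? λ γ → e v v γ Bool.≟ true)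
        where
        v = Fin.fromℕ< j<k
        tv : toℕ v ≡ j
        tv = FinP.toℕ-fromℕ< j<k
        atv : ∀ γ → mixed j v v γ ≡ e v v γ
        atv γ = mixed-≥ j v γ (λ lt → ℕₚ.<-irrefl tv lt)
        atv' : ∀ γ → mixed (suc j) v v γ ≡ e' v v γ
        atv' γ = mixed-< (suc j) v γ (s≤s (ℕₚ.≤-reflexive tv))
        other : ∀ a b γ → ¬ (a ≡ v × b ≡ v) → mixed (suc j) a b γ ≡ mixed j a b γ
        other a b γ ne = mixed-other j a b γ λ (ta , ab) →
          let av = FinP.toℕ-injective (trans ta (sym tv)) in ne (av , trans (sym ab) av)
        unchanged : (∀ γ → e' v v γ ≡ e v v γ) → WireHom (graph (mixed j)) (graph (mixed (suc j)))
        unchanged eq = Sym.fwd (isoS (iso-pointwise (λ _ → refl) pw)) ◅ ε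
          where
          pw : ∀ a b γ → mixed (suc j) a b γ ≡ mixed j a b γ
          pw a b γ with a Fin.≟ v | b Fin.≟ v
          ... | yes refl | yes refl = trans (atv' γ) (trans (eq γ) (sym (atv γ)))
          ... | no na | _ = other a b γ (na ∘ proj₁)
          ... | yes _ | no nb = other a b γ (nb ∘ proj₂)
        by-cases : Dec (isWire (l v) ≡ true) → Dec (Σ (ELab s) λ γ → e v v γ ≡ true) →
          WireHom (graph (mixed j)) (graph (mixed (suc j)))
        by-cases (no nw) _ = unchanged (λ γ → off v v γ (nw ∘ proj₂))
        by-cases (yes w) (no nl) = unchanged (λ γ →
          trans (BoolP.¬-not (λ x → nl (on' v w (γ , x)))) (sym (BoolP.¬-not (λ x → nl (γ , x)))))
        by-cases (yes w) (yes (δ , p)) =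
          let δ' , p' = on v w (δ , p)
              lp , iso = isolated deg v δ w p
              lp' , _ = isolated deg' v δ' w p'
          in relabel-loop l (mixed j) (mixed (suc j)) v δ δ' w
               (λ γ → trans (atv γ) (lp γ)) (λ γ → trans (atv' γ) (lp' γ))
               (λ b γ ne → trans (mixed-off j v b γ (ne ∘ sym)) (proj₁ (iso b γ ne)) ,
                           trans (mixed-off j b v γ ne) (proj₂ (iso b γ ne)))
               other

      steps : ∀ j → j ≤ k → WireHom (graph (mixed 0)) (graph (mixed j))
      steps zero _ = ε
      steps (suc j) lt = steps j (ℕₚ.<⇒≤ lt) ◅◅ step j lt

      start : ∀ a b γ → mixed 0 a b γ ≡ e a b γ
      start a b γ with a Fin.≟ b
      ... | yes _ = refl
      ... | no _  = refl

      finish : ∀ a b γ → e' a b γ ≡ mixed k a b γ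
      finish a b γ = by-cases (a Fin.≟ b)
        where
        by-cases : Dec (a ≡ b) → e' a b γ ≡ mixed k a b γ
        by-cases (yes refl) = sym (mixed-< k a γ (FinP.toℕ<n a))
        by-cases (no ne) = trans (off a b γ (ne ∘ proj₁)) (sym (mixed-off k a b γ ne))

    relabel-loops : WireHom (graph e) (graph e')
    relabel-loops = Sym.fwd (isoS (iso-pointwise (λ _ → refl) start)) ◅ steps k ℕₚ.≤-refl
                    ◅◅ Sym.fwd (isoS (iso-pointwise (λ _ → refl) finish)) ◅ ε

-- Normal forms and decidability of wire-homeomorphism

module _ {s : Sig} where

  record Contraction (G : Graph s) (v v' : Fin (n G)) : Set where
    field
      result   : Graph s
      size     : suc (n result) ≡ n G
      wireHom  : WireHom G result
      deg      : WireDeg≤1 result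
      string   : IsStringGraph G → (∀ δ → edge G v' v δ ≡ false) → IsStringGraph result
      matching : ∀ {K} (M : Matching K G) →
        ¬ (Σ (Fin (n K)) (λ c → Matching.m M c ≡ v) × Σ (Fin (n K)) (λ c → Matching.m M c ≡ v')) →
        Matching K result

  contract : ∀ (G : Graph s) v v' → WireDeg≤1 G → v ≢ v' → Inner G v v' → Contraction G v v'
  contract record { n = zero } ()
  contract G@record { n = suc m ; lab = l ; edge = e } v v' deg ne (sw , γ , p)
    -- Writes `v` as `punchIn v' v₀`, the form in which `MergeWires` takes it.
    with punchOut (ne ∘ sym) | FinP.punchIn-punchOut (ne ∘ sym)
  ... | v₀ | refl = record
    { result = merged ; size = refl ; wireHom = merge-wireHom sw p deg ; deg = merged-deg sw p deg
    ; string = merged-string sw p deg ; matching = merged-matching sw p deg }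
    where open MergeWires l e v' v₀ γ

  Reduced : Graph s → Set
  Reduced G = ∀ {a b} → Inner G a b → a ≡ b

  record Reduction (G : Graph s) : Set where
    field
      result  : Graph s
      wireHom : WireHom G result
      deg     : WireDeg≤1 result
      reduced : Reduced result

  reduce : ∀ k (G : Graph s) → n G ≡ k → WireDeg≤1 G → Reduction G
  reduce k G eq deg
    with FinP.any? (λ a → FinP.any? (λ b → inner? G a b ×-dec ¬? (a Fin.≟ b)))
  reduce k G eq deg | no ¬p =
    record { result = G ; wireHom = ε ; deg = deg ; reduced = reduced }
    where
    reduced : Reduced G
    reduced {a} {b} i with a Fin.≟ b
    ... | yes p = p
    ... | no ne = ⊥-elim (¬p (a , b , i , ne))
  reduce zero G eq deg | yes (a , _) with () ← subst Fin eq a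
  reduce (suc k) G eq deg | yes (a , b , i , ne) =
    record { result = R.result ; wireHom = C.wireHom ◅◅ R.wireHom ; deg = R.deg ; reduced = R.reduced }
    where
    module C = Contraction (contract G a b deg ne i)
    module R = Reduction (reduce k C.result (ℕₚ.suc-injective (trans C.size eq)) C.deg)

  -- isomorphism up to the labels of the loops at wire-vertices, i.e. of the wires that are closed up to one vertex
  record LoopIso (G H : Graph s) : Set where
    constructor loopIso
    field
      to      : Fin (n G) → Fin (n H)
      from    : Fin (n H) → Fin (n G)
      from∘to : ∀ a → from (to a) ≡ a
      to∘from : ∀ b → to (from b) ≡ b
      labPres : ∀ a → lab H (to a) ≡ lab G a
      off     : ∀ a b γ → ¬ (a ≡ b × isWire (lab G a) ≡ true) → edge H (to a) (to b) γ ≡ edge G a b γ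
      loop    : ∀ a → Inner G a a → Inner H (to a) (to a)
      loop⁻¹  : ∀ a → Inner H (to a) (to a) → Inner G a a

  loopIso? : ∀ (G H : Graph s) → Dec (LoopIso G H)
  loopIso? G H =
    map′ (λ (t , f , ft , tf , l , o , p , q) → loopIso t f ft tf l o p q)
         (λ (loopIso t f ft tf l o p q) → t , f , ft , tf , l , o , p , q)
         (searchFun refl (searchFin _) _
           (λ e (f , ft , tf , l , o , p , q) → f
             , (λ a → trans (cong f (sym (e a))) (ft a))
             , (λ b → trans (sym (e _)) (tf b))
             , (λ a → trans (cong (lab H) (sym (e a))) (l a))
             , (λ a b γ ne → trans (cong₂ (λ x y → edge H x y γ) (sym (e a)) (sym (e b))) (o a b γ ne))
             , (λ a i → subst (λ x → Inner H x x) (e a) (p a i))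
             , (λ a i → q a (subst (λ x → Inner H x x) (sym (e a)) i)))
           λ t → searchFun refl (searchFin _) _
             (λ e (ft , tf , rest) → (λ a → trans (sym (e _)) (ft a)) , (λ b → trans (cong t (sym (e b))) (tf b)) , rest)
             λ f → FinP.all? (λ a → f (t a) Fin.≟ a) ×-dec FinP.all? (λ b → t (f b) Fin.≟ b)
               ×-dec FinP.all? (λ a → lab H (t a) ≟L lab G a)
               ×-dec FinP.all? (λ a → FinP.all? λ b → all-elab? λ γ →
                       ¬? ((a Fin.≟ b) ×-dec isWire? (lab G a)) →-dec (edge H (t a) (t b) γ Bool.≟ edge G a b γ))
               ×-dec FinP.all? (λ a → inner? G a a →-dec inner? H (t a) (t a))
               ×-dec FinP.all? (λ a → inner? H (t a) (t a) →-dec inner? G a a))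

  loopIso⇒wireHom : ∀ {G H : Graph s} → WireDeg≤1 G → WireDeg≤1 H → LoopIso G H → WireHom G H
  loopIso⇒wireHom {G} {H} degG degH i =
    RelabelLoops.relabel-loops (lab G) (edge G) e' degG deg' off
      (λ a w (γ , x) → proj₂ (loop a ((w , refl) , γ , x)))
      (λ a w (γ , x) → proj₂ (loop⁻¹ a ((trans (cong isWire (labPres a)) w , refl) , γ , x)))
    ◅◅ Sym.fwd (isoS iso) ◅ ε
    where
    open LoopIso i
    e' : Fin (n G) → Fin (n G) → ELab s → Bool
    e' a b γ = edge H (to a) (to b) γ
    to-injective : ∀ {a b} → to a ≡ to b → a ≡ b
    to-injective {a} {b} p = trans (sym (from∘to a)) (trans (cong from p) (from∘to b))
    deg' : WireDeg≤1 (graphOn (lab G) e')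
    deg' v w = (λ a b γ δ x y → let p , q = proj₁ (degH (to v) w') _ _ _ _ x y in to-injective p , q) ,
               (λ a b γ δ x y → let p , q = proj₂ (degH (to v) w') _ _ _ _ x y in to-injective p , q)
      where w' = trans (cong isWire (labPres v)) w
    iso : Iso (graphOn (lab G) e') H
    iso = record { to = to ; from = from ; from∘to = from∘to ; to∘from = to∘from
                 ; labPres = labPres ; edgePres = λ _ _ _ → refl }

  reduced-same : ∀ {G : Graph s} → Reduced G → ∀ {a b} → Same G a b → a ≡ b
  reduced-same r ε = refl
  reduced-same r (Sym.fwd i ◅ p) = trans (r i) (reduced-same r p)
  reduced-same r (Sym.bwd i ◅ p) = trans (sym (r i)) (reduced-same r p)

  module _ {G H : Graph s} (rG : Reduced G) (rH : Reduced H) (M : Mor G H) where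
    open Mor M

    mor-edge : ∀ a b γ → ¬ SameWire G a b → edge G a b γ ≡ true → edge H (f a) (f b) γ ≡ true
    mor-edge a b γ ns e with a' , b' , sa , sb , e' ← proper a b γ ns e
      with refl ← reduced-same rH sa | refl ← reduced-same rH sb = e'

    -- A wire-vertex without a loop is a head, and heads are preserved.
    mor-loop : ∀ a → Inner H (f a) (f a) → Inner G a a
    mor-loop a i with inner? G a a
    ... | yes p = p
    ... | no ¬p with h , sh , hd ← headed a (λ b j → ¬p (subst (λ x → Inner G x a) (rG j) j))
      with refl ← reduced-same rH sh = ⊥-elim (hd (f a) i)

  -- The classes of `Same` are singletons in reduced graphs, so the two maps are inverse bijections
  -- and `proper` preserves edges exactly. Inner edges are not covered by `proper`, but in a reduced
  -- graph they are all loops, and `mor-loop` handles these.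
  corr⇒loopIso : ∀ {G H : Graph s} → Reduced G → Reduced H → Corr G H → LoopIso G H
  corr⇒loopIso {G} {H} rG rH c = record
    { to = T.f ; from = F.f ; from∘to = ft ; to∘from = tf
    ; labPres = T.labEq ; off = off
    ; loop = λ a i → mor-loop rH rG from (T.f a) (subst (λ x → Inner G x x) (sym (ft a)) i)
    ; loop⁻¹ = mor-loop rG rH to }
    where
    open Corr c
    module T = Mor to
    module F = Mor from
    ft : ∀ a → F.f (T.f a) ≡ a
    ft a = reduced-same rG (from∘to a)
    tf : ∀ b → T.f (F.f b) ≡ b
    tf b = reduced-same rH (to∘from b)
    off : ∀ a b γ → ¬ (a ≡ b × isWire (lab G a) ≡ true) → edge H (T.f a) (T.f b) γ ≡ edge G a b γ
    off a b γ ne with sameWire? G a b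
    ... | yes sw = trans (BoolP.¬-not λ x → ne (trans (sym (ft a)) (trans (cong F.f (rH (swH , γ , x))) (ft b)) , proj₁ sw))
                         (sym (BoolP.¬-not λ x → ne (rG (sw , γ , x) , proj₁ sw)))
      where swH = sameWire-cong {G = H} {H = G} (sym (T.labEq a)) (sym (T.labEq b)) sw
    ... | no ns = bool-ext
      (λ x → trans (cong₂ (λ y z → edge G y z γ) (sym (ft a)) (sym (ft b)))
               (mor-edge rH rG from _ _ γ (ns ∘ sameWire-cong {G = G} {H = H} (T.labEq a) (T.labEq b)) x))
      (mor-edge rG rH to a b γ ns)

  -- Normal forms are not unique, as the label of a loop depends on the merges chosen. `LoopIso`
  -- ignores exactly these labels, and since a wire-homeomorphism can exchange them, the test is
  -- exact.
  wireHom? : ∀ (G H : Graph s) → WireDeg≤1 G → WireDeg≤1 H → Dec (WireHom G H)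
  wireHom? G H dG dH =
    map′ (λ i → RG.wireHom ◅◅ loopIso⇒wireHom RG.deg RH.deg i ◅◅ Eq.symmetric _ RH.wireHom)
         (λ h → corr⇒loopIso RG.reduced RH.reduced
                  (wireHom⇒corr (Eq.symmetric _ RG.wireHom ◅◅ h ◅◅ RH.wireHom)))
         (loopIso? RG.result RH.result)
    where
    module RG = Reduction (reduce _ G refl dG)
    module RH = Reduction (reduce _ H refl dH)

-- Decidability of matching up to wire-homeomorphism

module _ {s : Sig} where

  inDeg≤1? : ∀ (G : Graph s) v → Dec (InDeg≤1 G v)
  inDeg≤1? G v = FinP.all? λ a → FinP.all? λ b → all-elab? λ γ → all-elab? λ δ →
    (edge G a v γ Bool.≟ true) →-dec ((edge G b v δ Bool.≟ true) →-dec ((a Fin.≟ b) ×-dec (γ ≟E δ)))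

  outDeg≤1? : ∀ (G : Graph s) v → Dec (OutDeg≤1 G v)
  outDeg≤1? G v = FinP.all? λ a → FinP.all? λ b → all-elab? λ γ → all-elab? λ δ →
    (edge G v a γ Bool.≟ true) →-dec ((edge G v b δ Bool.≟ true) →-dec ((a Fin.≟ b) ×-dec (γ ≟E δ)))

  isStringGraph? : ∀ (G : Graph s) → Dec (IsStringGraph G)
  isStringGraph? G =
    map′ (λ (a , b , c , d , e) → record { loopless = a ; terminal = b ; noNodeNode = c ; wireIn = d ; wireOut = e })
         (λ S → let open IsStringGraph S in loopless , terminal , noNodeNode , wireIn , wireOut)
         ((FinP.all? λ v → all-elab? λ γ → edge G v v γ Bool.≟ false)
          ×-dec (FinP.all? λ v → isNT (lab G v) Bool.≟ false)
          ×-dec (FinP.all? λ v → FinP.all? λ w → all-elab? λ γ → (isNode (lab G v) Bool.≟ true)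
                   →-dec ((isNode (lab G w) Bool.≟ true) →-dec (edge G v w γ Bool.≟ false)))
          ×-dec (FinP.all? λ v → isWire? (lab G v) →-dec inDeg≤1? G v)
          ×-dec (FinP.all? λ v → isWire? (lab G v) →-dec outDeg≤1? G v))

  isBoundary? : ∀ (G : Graph s) v → Dec (IsBoundary G v)
  isBoundary? G v =
    (isWire? (lab G v) ×-dec FinP.all? λ a → all-elab? λ γ → edge G a v γ Bool.≟ false) ⊎-dec
    (isWire? (lab G v) ×-dec FinP.all? λ a → all-elab? λ γ → edge G v a γ Bool.≟ false)

  matching? : ∀ (L H : Graph s) → Dec (Matching L H)
  matching? L H =
    map′ (λ (m , i , l , e , o , p) → record { m = m ; injective = i ; labPres = l ; edgePres = e
                                              ; boundaryOut = o ; boundaryIn = p })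
         (λ M → let open Matching M in m , injective , labPres , edgePres , boundaryOut , boundaryIn)
         (searchFun refl (searchFin _) _
           (λ {f} {g} q (i , l , e , o , p) →
             (λ a b x → i a b (trans (q a) (trans x (sym (q b))))) ,
             (λ a → trans (cong (lab H) (sym (q a))) (l a)) ,
             (λ a b γ x → trans (cong₂ (λ y z → edge H y z γ) (sym (q a)) (sym (q b))) (e a b γ x)) ,
             (λ a b γ x y → o a b γ (trans (cong (λ z → edge H z b γ) (q a)) x) (λ c z → y c (trans (sym (q c)) z))) ,
             (λ a b γ x y → p a b γ (trans (cong (λ z → edge H b z γ) (q a)) x) (λ c z → y c (trans (sym (q c)) z))))
           λ m → (FinP.all? λ a → FinP.all? λ b → (m a Fin.≟ m b) →-dec (a Fin.≟ b))
             ×-dec (FinP.all? λ a → lab H (m a) ≟L lab L a)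
             ×-dec (FinP.all? λ a → FinP.all? λ b → all-elab? λ γ →
                      (edge L a b γ Bool.≟ true) →-dec (edge H (m a) (m b) γ Bool.≟ true))
             ×-dec (FinP.all? λ a → FinP.all? λ b → all-elab? λ γ → (edge H (m a) b γ Bool.≟ true)
                      →-dec ((FinP.all? λ c → ¬? (m c Fin.≟ b)) →-dec isBoundary? L a))
             ×-dec (FinP.all? λ a → FinP.all? λ b → all-elab? λ γ → (edge H b (m a) γ Bool.≟ true)
                      →-dec ((FinP.all? λ c → ¬? (m c Fin.≟ b)) →-dec isBoundary? L a)))

  string-deg : ∀ {G : Graph s} → IsStringGraph G → WireDeg≤1 G
  string-deg S v w = IsStringGraph.wireIn S v w , IsStringGraph.wireOut S v w

  -- Bounding the host of a matching

  Image : ∀ {K G : Graph s} → Matching K G → Fin (n G) → Set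
  Image {K} M u = Σ (Fin (n K)) λ c → Matching.m M c ≡ u

  image? : ∀ {K G : Graph s} (M : Matching K G) u → Dec (Image M u)
  image? M u = FinP.any? λ c → Matching.m M c Fin.≟ u

  -- Outside the matched part, wire-vertices can only be merged within wires closed up to two vertices,
  -- where the merge would create a loop.
  Shrunk : ∀ {K G : Graph s} → Matching K G → Set
  Shrunk {K} {G} M = ∀ u v → u ≢ v → Inner G u v → ¬ (Image M u × Image M v) → Inner G v u

  record ShrunkMatching (K G : Graph s) : Set where
    field
      result   : Graph s
      wireHom  : WireHom G result
      string   : IsStringGraph result
      matching : Matching K result
      shrunk   : Shrunk matching

  shrink : ∀ k {K} (G : Graph s) → n G ≡ k → IsStringGraph G → Matching K G → ShrunkMatching K G
  shrink k G eq S M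
    with FinP.any? (λ a → FinP.any? λ b → inner? G a b ×-dec ¬? (a Fin.≟ b)
           ×-dec ¬? (image? M a ×-dec image? M b) ×-dec ¬? (inner? G b a))
  shrink k G eq S M | no ¬p =
    record { result = G ; wireHom = ε ; string = S ; matching = M ; shrunk = shrunk }
    where
    shrunk : Shrunk M
    shrunk u v ne i ni with inner? G v u
    ... | yes p = p
    ... | no nj = ⊥-elim (¬p (u , v , i , ne , ni , nj))
  shrink zero G eq S M | yes (a , _) with () ← subst Fin eq a
  shrink (suc k) G eq S M | yes (a , b , i , ne , ni , nj) =
    record { result = R.result ; wireHom = C.wireHom ◅◅ R.wireHom ; string = R.string
           ; matching = R.matching ; shrunk = R.shrunk }
    where
    module C = Contraction (contract G a b (string-deg S) ne i)
    sw' : SameWire G b a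
    sw' = trans (cong isWire (sym (proj₂ (proj₁ i)))) (proj₁ (proj₁ i)) , sym (proj₂ (proj₁ i))
    module R = ShrunkMatching
      (shrink k C.result (ℕₚ.suc-injective (trans C.size eq))
        (C.string S λ δ → BoolP.¬-not λ x → nj (sw' , δ , x)) (C.matching M ni))

  inner-out : ∀ {G : Graph s} → WireDeg≤1 G → ∀ {a b c} → Inner G a b → Inner G a c → b ≡ c
  inner-out deg ((w , _) , _ , x) (_ , _ , y) = proj₁ (proj₂ (deg _ w) _ _ _ _ x y)

  inner-in : ∀ {G : Graph s} → WireDeg≤1 G → ∀ {a b c} → Inner G a c → Inner G b c → a ≡ b
  inner-in deg ((w , l) , _ , x) (_ , _ , y) = proj₁ (proj₁ (deg _ (trans (cong isWire (sym l)) w)) _ _ _ _ x y)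

  module _ {K G H : Graph s} (S : IsStringGraph G) (M : Matching K G) (sh : Shrunk M) (c : Corr G H) where
    private
      deg = string-deg S
      φ = Mor.f (Corr.to c)

    -- Any inner edge between an unmatched `u` and another vertex has a reverse, by `Shrunk`. The
    -- degree bounds then leave no way out of the two-vertex cycle. The starting point `a` is either
    -- of its vertices so that the induction along the zigzag goes through.
    same-cases : ∀ {u} → ¬ Image M u → ∀ {a x} → a ≡ u ⊎ (Inner G u a × Inner G a u) → Same G a x →
      x ≡ u ⊎ (Inner G u x × Inner G x u)
    same-cases ni q ε = q
    same-cases {u} ni (inj₁ refl) (_◅_ {j = b} (Sym.fwd i) p) with u Fin.≟ b
    ... | yes refl = same-cases ni (inj₁ refl) p
    ... | no ne    = same-cases ni (inj₂ (i , sh u b ne i (ni ∘ proj₁))) p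
    same-cases {u} ni (inj₁ refl) (_◅_ {j = b} (Sym.bwd i) p) with b Fin.≟ u
    ... | yes refl = same-cases ni (inj₁ refl) p
    ... | no ne    = same-cases ni (inj₂ (sh b u ne i (ni ∘ proj₂) , i)) p
    same-cases ni (inj₂ (i , j)) (Sym.fwd k ◅ p) = same-cases ni (inj₁ (inner-out deg k j)) p
    same-cases ni (inj₂ (i , j)) (Sym.bwd k ◅ p) = same-cases ni (inj₁ (inner-in deg k i)) p

    private
      -- distinguishes the two vertices of a wire closed up to two vertices
      smaller? : ∀ u → Dec (Σ (Fin (n G)) λ w → (w Fin.< u) × Inner G u w)
      smaller? u = FinP.any? λ w → (w Fin.<? u) ×-dec inner? G u w

      bit : Fin (n G) → Fin 2
      bit u with smaller? u
      ... | yes _ = suc zero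
      ... | no _  = zero

      bit-≢ : ∀ {u v} → u Fin.< v → Inner G u v → Inner G v u → bit u ≢ bit v
      bit-≢ {u} {v} lt i j with smaller? u | smaller? v
      ... | yes (w , lt' , k) | _ = λ _ → ℕₚ.<-asym lt (subst (Fin._< u) (inner-out deg k i) lt')
      ... | no _ | yes _ = λ ()
      ... | no _ | no ¬p = λ _ → ¬p (u , lt , j)

      -- A matched vertex is coded by its preimage in `K`. An unmatched one is determined by its
      -- vertex in `H` up to the partner in a two-vertex cycle, which costs one extra bit.
      code : Fin (n G) → Fin (n K + n H * 2)
      code u with image? M u
      ... | yes (a , _) = a ↑ˡ (n H * 2)
      ... | no _        = n K ↑ʳ Fin.combine (φ u) (bit u)

      code-injective : ∀ {u v} → code u ≡ code v → u ≡ v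
      code-injective {u} {v} p with image? M u | image? M v
      ... | yes (a , pa) | yes (b , pb) = trans (sym pa) (trans (cong (Matching.m M) (FinP.↑ˡ-injective _ _ _ p)) pb)
      ... | yes _ | no _ = ⊥-elim (↑ˡ≢↑ʳ p)
      ... | no _ | yes _ = ⊥-elim (↑ˡ≢↑ʳ (sym p))
      ... | no ni | no _
        with eφ , eb ← FinP.combine-injective (φ u) (bit u) (φ v) (bit v) (FinP.↑ʳ-injective _ _ _ p)
        with same-cases ni (inj₁ refl)
               (Eq.symmetric _ (Corr.from∘to c u) ◅◅ subst (λ x → Same G (Mor.f (Corr.from c) x) v) (sym eφ) (Corr.from∘to c v))
      ...   | inj₁ q = sym q
      ...   | inj₂ (i , j) with FinP.<-cmp u v
      ...     | tri< lt _ _ = ⊥-elim (bit-≢ lt i j eb)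
      ...     | tri≈ _ q _ = q
      ...     | tri> _ _ gt = ⊥-elim (bit-≢ gt j i (sym eb))

    shrunk-size : n G ≤ n K + n H * 2
    shrunk-size = FinP.injective⇒≤ code-injective

  iso-string : ∀ {G H : Graph s} → Iso G H → IsStringGraph G → IsStringGraph H
  iso-string {G} {H} i S = record
    { loopless = λ v γ → trans (sym (edgePres v v γ)) (S.loopless (to v) γ)
    ; terminal = λ v → trans (cong isNT (sym (labPres v))) (S.terminal (to v))
    ; noNodeNode = λ v w γ x y → trans (sym (edgePres v w γ))
        (S.noNodeNode _ _ γ (trans (cong isNode (labPres v)) x) (trans (cong isNode (labPres w)) y))
    ; wireIn = λ v x a b γ δ y z →
        let p , q = S.wireIn (to v) (trans (cong isWire (labPres v)) x) _ _ γ δ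
                      (trans (edgePres a v γ) y) (trans (edgePres b v δ) z)
        in to-injective p , q
    ; wireOut = λ v x a b γ δ y z →
        let p , q = S.wireOut (to v) (trans (cong isWire (labPres v)) x) _ _ γ δ
                      (trans (edgePres v a γ) y) (trans (edgePres v b δ) z)
        in to-injective p , q }
    where
    module S = IsStringGraph S
    open Iso (iso-sym i)
    to-injective : ∀ {a b} → to a ≡ to b → a ≡ b
    to-injective {a} {b} p = trans (sym (from∘to a)) (trans (cong from p) (from∘to b))

  iso-matching : ∀ {K G H : Graph s} → Iso G H → Matching K G → Matching K H
  iso-matching {K} {G} {H} i M = record
    { m = to ∘ m
    ; injective = λ a b p → injective a b (trans (sym (from∘to _)) (trans (cong from p) (from∘to _)))
    ; labPres = λ a → trans (I.labPres _) (labPres a)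
    ; edgePres = λ a b γ x → trans (I.edgePres _ _ γ) (edgePres a b γ x)
    ; boundaryOut = λ a b γ x o → boundaryOut a (from b) γ
        (trans (sym (I.edgePres _ _ γ)) (trans (cong (λ z → edge H _ z γ) (to∘from b)) x))
        (λ c p → o c (trans (cong to p) (to∘from b)))
    ; boundaryIn = λ a b γ x o → boundaryIn a (from b) γ
        (trans (sym (I.edgePres _ _ γ)) (trans (cong (λ z → edge H z _ γ) (to∘from b)) x))
        (λ c p → o c (trans (cong to p) (to∘from b))) }
    where
    module I = Iso i
    open I using (to; from; from∘to; to∘from)
    open Matching M

  hasMatching? : ∀ (K H : Graph s) → IsStringGraph H → Dec (HasMatching K H)
  hasMatching? K H SH = map′ (λ (j , l , e , p) → _ , p) bounded
      (FinP.any? λ j → searchFun refl searchLab _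
        (λ p (e , q) → e , move (iso-pointwise (sym ∘ p) (λ _ _ _ → refl)) q)
        λ l → searchFun (λ _ _ → refl) (searchFun (λ _ → refl) searchELabPred _) _
          (λ p → move (iso-pointwise (λ _ → refl) (λ a b γ → sym (p a b γ))))
          λ e → good? (graph j l e))
    where
    Good : Graph s → Set
    Good G = IsStringGraph G × WireHom H G × Matching K G

    -- The search changes labellings and edge relations to pointwise equal ones. The resulting
    -- graphs need not be propositionally equal, but they are isomorphic, and a renaming is an
    -- elementary step of `WireHom`.
    move : ∀ {G G'} → Iso G G' → Good G → Good G'
    move i (S , h , M) = iso-string i S , h ◅◅ Sym.fwd (isoS i) ◅ ε , iso-matching i M

    good? : ∀ G → Dec (Good G)
    good? G with isStringGraph? G
    ... | no ¬S = no (¬S ∘ proj₁)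
    ... | yes S = map′ (S ,_) proj₂ (wireHom? H G (string-deg SH) (string-deg S) ×-dec matching? K G)

    graph : (j : Fin (suc (n K + n H * 2))) → (Fin (toℕ j) → Lab s) →
      (Fin (toℕ j) → Fin (toℕ j) → ELab s → Bool) → Graph s
    graph j = graphOn

    bounded : HasMatching K H → Σ _ λ j → Σ _ λ l → Σ _ λ e → Good (graph j l e)
    bounded (G , S , h , M) = result (R.result) size (R.string , hR , R.matching)
      where
      module R = ShrunkMatching (shrink _ G refl S M)
      hR = h ◅◅ R.wireHom
      size = shrunk-size R.string R.matching R.shrunk (wireHom⇒corr (Eq.symmetric _ hR))
      result : ∀ G → n G ≤ n K + n H * 2 → Good G → Σ _ λ j → Σ _ λ l → Σ _ λ e → Good (graph j l e)
      result record { n = k ; lab = l ; edge = e } le g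
        with Fin.fromℕ< (s≤s le) | FinP.toℕ-fromℕ< (s≤s le)
      ... | j | refl = j , l , e , g

-- Marked vertices of sentential forms

any-true : ∀ {A : Set} {f : A → Bool} {xs x} → x ∈ xs → f x ≡ true → any f xs ≡ true
any-true {f = f} {_ ∷ xs} (here refl) p = cong (_∨ any f xs) p
any-true {f = f} {y ∷ xs} (there q) p = trans (cong (f y ∨_) (any-true {f = f} q p)) (BoolP.∨-zeroʳ (f y))

data Tag : Set where
  vertexTag circleTag : Tag
  endTag : Dir → Tag

module _ {s : Sig} where

  adj : (G : Graph s) → Dir → Fin (n G) → Fin (n G) → ELab s → Bool
  adj G inD u b γ  = edge G u b γ
  adj G outD u b γ = edge G b u γ

  -- A union of closed wires, given as a set closed under neighbours. No individual cycle has to be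
  -- traced, and all wire-vertices of a body can be taken together.
  record Circle (G : Graph s) (C : Fin (n G) → Set) : Set where
    field
      wires : ∀ {v} → C v → isWire (lab G v) ≡ true
      next  : ∀ {v} → C v → Σ (Fin (n G)) λ w → Σ (ELab s) λ γ → C w × edge G v w γ ≡ true
      prev  : ∀ {v} → C v → Σ (Fin (n G)) λ w → Σ (ELab s) λ γ → C w × edge G w v γ ≡ true

  module _ (P : List (Production {s})) where

    -- In direction d, the wire-vertex u is adjacent to a node-vertex,
    -- or to a non-terminal whose expansions all keep it attached.
    Attached : (G : Graph s) → Dir → Fin (n G) → Set
    Attached G d u = Σ (Fin (Sig.nWire s)) λ W → lab G u ≡ wire W ×
      Σ (Fin (n G)) λ b → Σ (ELab s) λ γ → adj G d u b γ ≡ true ×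
        (isNode (lab G b) ≡ true ⊎ Σ (Fin (Sig.nNT s)) λ Y → lab G b ≡ nt Y × AllHaveInstr P Y W γ d)

    -- `O` stands for the other marks. A node-vertex or an end in a given direction will be
    -- determined by its class in the host. A closed wire has no distinguished vertex, so `circle`
    -- must itself demand that no other mark lies on `C`.
    data Good (G : Graph s) (O : Fin (n G) → Set) : Tag → Fin (n G) → Set₁ where
      vertex : ∀ {u} → isNode (lab G u) ≡ true → Good G O vertexTag u
      end    : ∀ {d u} → Attached G d u → Good G O (endTag d) u
      circle : ∀ {u} (C : Fin (n G) → Set) → Circle G C → C u → (∀ {x} → O x → ¬ C x) → Good G O circleTag u

    record Marks (G : Graph s) (k : ℕ) : Set₁ where
      field
        mark : Fin k → Fin (n G)
        injective : ∀ {i j} → mark i ≡ mark j → i ≡ j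
        tag  : Fin k → Tag
        good : ∀ i → Good G (λ x → Σ (Fin k) λ j → j ≢ i × x ≡ mark j) (tag i) (mark i)

    -- The common part of grammar and decoding steps. `ρ` omits non-terminals because a grammar step
    -- deletes one, and `ρ-edge` speaks only of edges at wire-vertices because a decoding step
    -- deletes an edge between node-vertices.
    record Extension (G G' : Graph s) : Set where
      field
        ρ : ∀ u → isNT (lab G u) ≡ false → Fin (n G')
        ρ-injective : ∀ {u v p q} → ρ u p ≡ ρ v q → u ≡ v
        ρ-lab  : ∀ u p → lab G' (ρ u p) ≡ lab G u
        ρ-edge : ∀ u v p q γ → isWire (lab G u) ≡ true ⊎ isWire (lab G v) ≡ true →
                 edge G u v γ ≡ true → edge G' (ρ u p) (ρ v q) γ ≡ true
        ρ-nt   : ∀ u p W b Y γ d → lab G u ≡ wire W → lab G b ≡ nt Y → adj G d u b γ ≡ true →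
                 AllHaveInstr P Y W γ d → Attached G' d (ρ u p)

    node-nonNT : ∀ {l : Lab s} → isNode l ≡ true → isNT l ≡ false
    node-nonNT {node _} _ = refl

    wire-nonNT : ∀ {l : Lab s} → isWire l ≡ true → isNT l ≡ false
    wire-nonNT {wire _} _ = refl

    good-nonNT : ∀ {G O t u} → Good G O t u → isNT (lab G u) ≡ false
    good-nonNT (vertex x) = node-nonNT x
    good-nonNT (end (W , e , _)) = cong isNT e
    good-nonNT (circle C c cu _) = wire-nonNT (Circle.wires c cu)

    module _ {G G' : Graph s} (E : Extension G G') where
      open Extension E

      Old New : Fin (n G') → Set
      Old x' = Σ (Fin (n G)) λ u → Σ (isNT (lab G u) ≡ false) λ p → x' ≡ ρ u p
      New x' = ∀ u p → x' ≢ ρ u p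

      ρ-adj : ∀ d u b p q γ → isWire (lab G u) ≡ true → adj G d u b γ ≡ true → adj G' d (ρ u p) (ρ b q) γ ≡ true
      ρ-adj inD  u b p q γ w = ρ-edge u b p q γ (inj₁ w)
      ρ-adj outD u b p q γ w = ρ-edge b u q p γ (inj₂ w)

      -- The image of an old circle consists of old vertices, so a new mark cannot lie on it, and
      -- injectivity of `ρ` keeps the old marks off it.
      good-extend : ∀ {O O' t u} → Good G O t u → ∀ p →
        (∀ {x'} → O' x' → New x' ⊎ Σ (Fin (n G)) λ u → Σ (isNT (lab G u) ≡ false) λ p → O u × x' ≡ ρ u p) →
        Good G' O' t (ρ u p)
      good-extend (vertex x) p O'⊆ = vertex (trans (cong isNode (ρ-lab _ p)) x)
      good-extend (end {d} {u} (W , e , b , γ , a , inj₁ nb)) p O'⊆ =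
        end (W , trans (ρ-lab _ p) e , ρ b pb , γ , ρ-adj d u b p pb γ (cong isWire e) a
               , inj₁ (trans (cong isNode (ρ-lab b pb)) nb))
        where pb = node-nonNT nb
      good-extend (end {d} {u} (W , e , b , γ , a , inj₂ (Y , f , all))) p O'⊆ = end (ρ-nt u p W b Y γ d e f a all)
      good-extend {O} {O'} (circle {u} C c cu sep) p O'⊆ = circle C' c' (u , p , cu , refl) sep'
        where
        module c = Circle c
        C' : Fin (n G') → Set
        C' x' = Σ (Fin (n G)) λ u → Σ (isNT (lab G u) ≡ false) λ p → C u × x' ≡ ρ u p
        c' : Circle G' C'
        c' = record
          { wires = λ { (u , p , cu , refl) → trans (cong isWire (ρ-lab u p)) (c.wires cu) }
          ; next = λ { (u , p , cu , refl) →
              let w , γ , cw , e = c.next cu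
                  q = wire-nonNT (c.wires cw)
              in ρ w q , γ , (w , q , cw , refl) , ρ-edge u w p q γ (inj₁ (c.wires cu)) e }
          ; prev = λ { (u , p , cu , refl) →
              let w , γ , cw , e = c.prev cu
                  q = wire-nonNT (c.wires cw)
              in ρ w q , γ , (w , q , cw , refl) , ρ-edge w u q p γ (inj₁ (c.wires cw)) e } }
        sep' : ∀ {x'} → O' x' → ¬ C' x'
        sep' o (u , p , cu , refl) with O'⊆ o
        ... | inj₁ new = new u p refl
        ... | inj₂ (u' , p' , ou' , eq) with refl ← ρ-injective eq = sep ou' cu

      carry : ∀ {k} → Marks G k → Marks G' k
      carry M = record
        { mark = λ i → ρ (mark i) (good-nonNT (good i))
        ; injective = injective ∘ ρ-injective
        ; tag = tag
        ; good = λ i → good-extend (good i) _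
            λ { (j , ne , refl) → inj₂ (mark j , good-nonNT (good j) , (j , ne , refl) , refl) } }
        where open Marks M

      extend : ∀ {k} → Marks G k → ∀ {x t} → New x → Good G' Old t x → Marks G' (suc k)
      extend {k} M {x} {t} new gx = record { mark = mark' ; injective = inj' ; tag = tag' ; good = good' }
        where
        open Marks M
        mark' : Fin (suc k) → Fin (n G')
        mark' zero = x
        mark' (suc i) = ρ (mark i) (good-nonNT (good i))
        inj' : ∀ {i j} → mark' i ≡ mark' j → i ≡ j
        inj' {zero} {zero} _ = refl
        inj' {zero} {suc j} p = ⊥-elim (new _ _ p)
        inj' {suc i} {zero} p = ⊥-elim (new _ _ (sym p))
        inj' {suc i} {suc j} p = cong suc (injective (ρ-injective p))
        tag' : Fin (suc k) → Tag
        tag' zero = t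
        tag' (suc i) = tag i
        weaken : ∀ {O O' : Fin (n G') → Set} {t u} → (∀ {x} → O' x → O x) → Good G' O t u → Good G' O' t u
        weaken f (vertex p) = vertex p
        weaken f (end a) = end a
        weaken f (circle C c cu sep) = circle C c cu (sep ∘ f)
        good' : ∀ i → Good G' (λ x → Σ (Fin (suc k)) λ j → j ≢ i × x ≡ mark' j) (tag' i) (mark' i)
        good' zero = weaken (λ { (zero , ne , _) → ⊥-elim (ne refl) ; (suc j , _ , e) → _ , _ , e }) gx
        good' (suc i) = good-extend (good i) _
          λ { (zero , _ , refl) → inj₁ new
            ; (suc j , ne , refl) → inj₂ (mark j , good-nonNT (good j) , (j , ne ∘ cong suc , refl) , refl) }

  -- Marked vertices with the same tag lie on different wires of the host,
  -- so they are told apart by the vertices of the original graph they correspond to.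
  module _ {P : List (Production {s})} {K G H : Graph s} (S : IsStringGraph G) (M : Matching K G) (c : Corr G H) where
    private
      module S = IsStringGraph S
      module M = Matching M
      deg = string-deg S

      InnerD : Dir → Fin (n G) → Fin (n G) → Set
      InnerD inD a b  = Inner G a b
      InnerD outD a b = Inner G b a

      innerD-unique : ∀ d {a b b'} → InnerD d a b → InnerD d a b' → b ≡ b'
      innerD-unique inD  = inner-out deg
      innerD-unique outD = inner-in deg

      innerD-cases : ∀ d {a b} → Sym.SymClosure (Inner G) a b → InnerD d a b ⊎ InnerD d b a
      innerD-cases inD  (Sym.fwd i) = inj₁ i
      innerD-cases inD  (Sym.bwd i) = inj₂ i
      innerD-cases outD (Sym.fwd i) = inj₂ i
      innerD-cases outD (Sym.bwd i) = inj₁ i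

      End : Dir → Fin (n G) → Set
      End d x = isWire (lab G x) ≡ true ×
        Σ (Fin (n G)) λ b → Σ (ELab s) λ γ → adj G d x b γ ≡ true × isNode (lab G b) ≡ true

      end-last : ∀ d {x y} → End d x → ¬ InnerD d x y
      end-last inD (w , b , γ , e , nb) ((w' , l) , δ , e')
        with refl ← proj₁ (proj₂ (deg _ w) _ _ _ _ e e') = node≢wire nb (trans (cong isWire (sym l)) w)
      end-last outD (w , b , γ , e , nb) ((w' , l) , δ , e')
        with refl ← proj₁ (proj₁ (deg _ w) _ _ _ _ e e') = node≢wire nb w'

      -- Inner edges in direction `d` are functional and `x` has none. Along the zigzag, a step
      -- against `d` prolongs the path to `x`, and a step along `d` can only be the first edge of
      -- that path.
      end-reach : ∀ d {x y z} → End d x → Star (InnerD d) y x → Same G y z → Star (InnerD d) z x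
      end-reach d ex r ε = r
      end-reach d ex r (st ◅ p) with innerD-cases d st
      ... | inj₂ i = end-reach d ex (i ◅ r) p
      end-reach d ex ε (st ◅ p) | inj₁ i = ⊥-elim (end-last d ex i)
      end-reach d ex (j ◅ r) (st ◅ p) | inj₁ i with refl ← innerD-unique d i j = end-reach d ex r p

      same-end : ∀ d {x y} → End d x → End d y → Same G x y → x ≡ y
      same-end d ex ey p with end-reach d ex ε p
      ... | ε = refl
      ... | i ◅ _ = ⊥-elim (end-last d ey i)

      same-node : ∀ {x y} → isNode (lab G x) ≡ true → Same G x y → x ≡ y
      same-node nd ε = refl
      same-node nd (Sym.fwd ((w , _) , _) ◅ p) = ⊥-elim (node≢wire nd w)
      same-node nd (Sym.bwd ((w , l) , _) ◅ p) = ⊥-elim (node≢wire nd (trans (cong isWire (sym l)) w))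

      -- The images of the circle's own edges use up the in- and out-degrees of its vertices in the
      -- host, so no inner edge leads elsewhere.
      same-circle : ∀ {C} → Circle K C → ∀ {u y} → C u → Same G (M.m u) y → Σ (Fin (n K)) λ v → C v × M.m v ≡ y
      same-circle c cu ε = _ , cu , refl
      same-circle c {u} cu (Sym.fwd ((w , _) , _ , e) ◅ p)
        with v , γ , cv , e' ← Circle.next c cu
        with refl ← proj₁ (proj₂ (deg _ w) _ _ _ _ e (M.edgePres _ _ γ e')) = same-circle c cv p
      same-circle c {u} cu (Sym.bwd ((w , l) , _ , e) ◅ p)
        with v , γ , cv , e' ← Circle.prev c cu
        with refl ← proj₁ (proj₁ (deg _ (trans (cong isWire (sym l)) w)) _ _ _ _ e (M.edgePres _ _ γ e')) = same-circle c cv p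

      matched-end : ∀ {d u} → Attached P K d u → End d (M.m u)
      matched-end {d} {u} (W , l , b , γ , e , nb) =
        trans (cong isWire (M.labPres u)) (cong isWire l) , M.m b , γ , adj-pres d e , node-b nb
        where
        adj-pres : ∀ d → adj K d u b γ ≡ true → adj G d (M.m u) (M.m b) γ ≡ true
        adj-pres inD  = M.edgePres u b γ
        adj-pres outD = M.edgePres b u γ
        node-b : ∀ {A : Fin (Sig.nNT s) → Set} →
          isNode (lab K b) ≡ true ⊎ (Σ (Fin (Sig.nNT s)) λ Y → lab K b ≡ nt Y × A Y) → isNode (lab G (M.m b)) ≡ true
        node-b (inj₁ x) = trans (cong isNode (M.labPres b)) x
        -- Matchings preserve labels and the host is a string graph, so no matched vertex is a
        -- non-terminal.
        node-b (inj₂ (Y , lb , _))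
          with () ← trans (sym (S.terminal (M.m b))) (cong isNT (trans (M.labPres b) lb))

      separated : ∀ {O O' t u v} → Good P K O t u → Good P K O' t v → O v → Same G (M.m u) (M.m v) → u ≡ v
      separated (vertex x) _ _ p = M.injective _ _ (same-node (trans (cong isNode (M.labPres _)) x) p)
      separated (end {d} a) (end a') _ p = M.injective _ _ (same-end d (matched-end a) (matched-end a') p)
      separated (circle C c cu sep) _ o p
        with v' , cv' , q ← same-circle c cu p with refl ← M.injective _ _ q = ⊥-elim (sep o cv')

      tagCode : Tag → Fin 4
      tagCode vertexTag      = # 0
      tagCode circleTag      = # 1
      tagCode (endTag inD)   = # 2
      tagCode (endTag outD)  = # 3

      tagAt : Fin 4 → Tag
      tagAt zero                = vertexTag
      tagAt (suc zero)          = circleTag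
      tagAt (suc (suc zero))    = endTag inD
      tagAt (suc (suc (suc _))) = endTag outD

      tagAt-tagCode : ∀ t → tagAt (tagCode t) ≡ t
      tagAt-tagCode vertexTag     = refl
      tagAt-tagCode circleTag     = refl
      tagAt-tagCode (endTag inD)  = refl
      tagAt-tagCode (endTag outD) = refl

      tagCode-injective : ∀ {t t'} → tagCode t ≡ tagCode t' → t ≡ t'
      tagCode-injective {t} {t'} p = trans (sym (tagAt-tagCode t)) (trans (cong tagAt p) (tagAt-tagCode t'))

    -- The 4 counts the tags. The two directions need separate tags because one wire may have a
    -- node-vertex at both ends and carry a mark at each.
    marks-bound : ∀ {k} → Marks P K k → k ≤ 4 * n H
    marks-bound {k} Ms = FinP.injective⇒≤ {f = code} code-injective
      where
      open Marks Ms
      φ = Mor.f (Corr.to c)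
      code : Fin k → Fin (4 * n H)
      code i = Fin.combine (tagCode (tag i)) (φ (M.m (mark i)))
      code-injective : ∀ {i j} → code i ≡ code j → i ≡ j
      code-injective {i} {j} eq with i Fin.≟ j
      ... | yes p = p
      ... | no ne = injective (separated (good i) (subst (λ t → Good P K _ t _) (sym et) (good j))
                                (j , ne ∘ sym , refl) same-ij)
        where
        es = FinP.combine-injective (tagCode (tag i)) (φ (M.m (mark i))) (tagCode (tag j)) (φ (M.m (mark j))) eq
        et = tagCode-injective (proj₁ es)
        same-ij : Same G (M.m (mark i)) (M.m (mark j))
        same-ij = Eq.symmetric _ (Corr.from∘to c _) ◅◅
          subst (λ x → Same G (Mor.f (Corr.from c) x) _) (sym (proj₂ es)) (Corr.from∘to c _)

-- Grammar steps: counting non-terminals and carrying marks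

sum-++ : ∀ m {k} (t : Fin (m + k) → ℕ) → sum t ≡ sum (λ a → t (a ↑ˡ k)) + sum (λ x → t (m ↑ʳ x))
sum-++ zero t = refl
sum-++ (suc m) t = trans (cong (t zero +_) (sum-++ m (t ∘ suc))) (sym (ℕₚ.+-assoc (t zero) _ _))

module _ {s : Sig} where

  ntWeight : Lab s → ℕ
  ntWeight l = if isNT l then 1 else 0

  countNT : (G : Graph s) → ℕ
  countNT G = sum (λ a → ntWeight (lab G a))

  countNT-apply : ∀ (G : Graph s) v p → isNT (lab G v) ≡ true →
    suc (countNT (apply G v p)) ≡ countNT G + countNT (body p)
  countNT-apply record { n = zero } ()
  countNT-apply record { n = suc m ; lab = l ; edge = e } v p isnt = begin
    suc (sum (λ a → ntWeight (lab G' a)))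
      ≡⟨ cong suc (sum-++ m (λ a → ntWeight (lab G' a))) ⟩
    suc (sum (λ a → ntWeight (lab G' (a ↑ˡ k))) + sum (λ x → ntWeight (lab G' (m ↑ʳ x))))
      ≡⟨ cong₂ (λ x y → suc (x + y)) (sum-cong-≗ (λ a → cong (ntWeight) (old a))) (sum-cong-≗ (λ x → cong (ntWeight) (new x))) ⟩
    suc (sum (λ a → ntWeight (l (punchIn v a)))) + countNT (body p)
      ≡⟨ cong (λ w → w + sum (λ a → ntWeight (l (punchIn v a))) + countNT (body p)) (sym one) ⟩
    ntWeight (l v) + sum (λ a → ntWeight (l (punchIn v a))) + countNT (body p)
      ≡⟨ cong (_+ countNT (body p)) (sym (sum-remove {i = v} (λ a → ntWeight (l a)))) ⟩
    sum (λ a → ntWeight (l a)) + countNT (body p) ∎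
    where
    open ≡-Reasoning
    k = n (body p)
    G' = applyAt l e v p
    one : ntWeight (l v) ≡ 1
    one rewrite isnt = refl
    old : ∀ a → lab G' (a ↑ˡ k) ≡ l (punchIn v a)
    old a rewrite FinP.splitAt-↑ˡ m a k = refl
    new : ∀ x → lab G' (m ↑ʳ x) ≡ lab (body p) x
    new x rewrite FinP.splitAt-↑ʳ m k x = refl

  module _ (P : List (Production {s})) where

    record Expansion (G D G' : Graph s) : Set where
      field
        extension : Extension P G G'
        ν      : Fin (n D) → Fin (n G')
        ν-new  : ∀ x → New P extension (ν x)
        ν-lab  : ∀ x → lab G' (ν x) ≡ lab D x
        ν-edge : ∀ x y γ → edge D x y γ ≡ true → edge G' (ν x) (ν y) γ ≡ true

    -- A step contributes at most one mark, so within the body there are no others to avoid. In `G'`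
    -- a circle from the body avoids all of `Old`, since `ν` only reaches new vertices.
    good-body : ∀ {G D G' t x} (E : Expansion G D G') → Good P D (λ _ → ⊥) t x →
      Good P G' (Old P (Expansion.extension E)) t (Expansion.ν E x)
    good-body {G} {D} {G'} E = λ where
        (vertex nd) → vertex (trans (cong isNode (ν-lab _)) nd)
        (end {d} {u} (W , l , b , γ , a , nb)) →
          end (W , trans (ν-lab u) l , ν b , γ , ν-adj d u b γ a ,
            subst (λ lb → isNode lb ≡ true ⊎ Σ _ λ Y → lb ≡ nt Y × AllHaveInstr P Y W γ d) (sym (ν-lab b)) nb)
        (circle {u} C c cu _) → circle (image C) (circle-image C c) (u , cu , refl)
          (λ { (v , p , eq) (w , _ , eq') → ν-new w v p (trans (sym eq') eq) })
      where
      open Expansion E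
      ν-adj : ∀ d u b γ → adj D d u b γ ≡ true → adj G' d (ν u) (ν b) γ ≡ true
      ν-adj inD u b γ = ν-edge u b γ
      ν-adj outD u b γ = ν-edge b u γ
      image : (Fin (n D) → Set) → Fin (n G') → Set
      image C x' = Σ (Fin (n D)) λ x → C x × x' ≡ ν x
      circle-image : ∀ C → Circle D C → Circle G' (image C)
      circle-image C c = record
        { wires = λ { (x , cx , refl) → trans (cong isWire (ν-lab x)) (c.wires cx) }
        ; next = λ { (x , cx , refl) → let w , γ , cw , e = c.next cx in ν w , γ , (w , cw , refl) , ν-edge x w γ e }
        ; prev = λ { (x , cx , refl) → let w , γ , cw , e = c.prev cx in ν w , γ , (w , cw , refl) , ν-edge w x γ e } }
        where module c = Circle c

    module _ {m} (l : Fin (suc m) → Lab s) (e : Fin (suc m) → Fin (suc m) → ELab s → Bool)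
      (v : Fin (suc m)) (p : Production) (lv : l v ≡ nt (lhs p)) (p∈P : p ∈ P) (ok : ProdOK P p) where
      private
        module ok = ProdOK ok
        D = body p
        k = n D
        G G' : Graph s
        G = record { n = suc m ; lab = l ; edge = e }
        G' = applyAt l e v p

        old : ∀ {u} → u ≢ v → Fin (m + k)
        old ne = punchOut (ne ∘ sym) ↑ˡ k

        old-lab : ∀ {u} (ne : u ≢ v) → lab G' (old ne) ≡ l u
        old-lab ne rewrite FinP.splitAt-↑ˡ m (punchOut (ne ∘ sym)) k = cong l (FinP.punchIn-punchOut (ne ∘ sym))

        old-edge : ∀ {u w} (ne : u ≢ v) (ne' : w ≢ v) γ → edge G' (old ne) (old ne') γ ≡ e u w γ
        old-edge ne ne' γ
          rewrite FinP.splitAt-↑ˡ m (punchOut (ne ∘ sym)) k | FinP.splitAt-↑ˡ m (punchOut (ne' ∘ sym)) k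
          = cong₂ (λ a b → e a b γ) (FinP.punchIn-punchOut (ne ∘ sym)) (FinP.punchIn-punchOut (ne' ∘ sym))

        ν : Fin k → Fin (m + k)
        ν x = m ↑ʳ x

        ν-lab : ∀ x → lab G' (ν x) ≡ lab D x
        ν-lab x rewrite FinP.splitAt-↑ʳ m k x = refl

        ν-edge : ∀ x y γ → edge D x y γ ≡ true → edge G' (ν x) (ν y) γ ≡ true
        ν-edge x y γ eq rewrite FinP.splitAt-↑ʳ m k x | FinP.splitAt-↑ʳ m k y = eq

        embed : ∀ {u} (ne : u ≢ v) i → i ∈ emb p → Instr.σ i ≡ l u → adj G (Instr.d i) u v (Instr.β i) ≡ true →
          adj G' (Instr.d i) (old ne) (ν (Instr.x i)) (Instr.γ i) ≡ true
        embed {u} ne (instr σ β γ x inD) i∈ σ≡ a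
          rewrite FinP.splitAt-↑ˡ m (punchOut (ne ∘ sym)) k | FinP.splitAt-↑ʳ m k x
                | FinP.punchIn-punchOut (ne ∘ sym)
          = any-true i∈ (cong₂ _∧_ (trans (cong (_==L l u) σ≡) (==L-refl (l u)))
              (cong₂ _∧_ (==E-refl γ) (cong₂ _∧_ (==F-refl x) a)))
        embed {u} ne (instr σ β γ x outD) i∈ σ≡ a
          rewrite FinP.splitAt-↑ˡ m (punchOut (ne ∘ sym)) k | FinP.splitAt-↑ʳ m k x
                | FinP.punchIn-punchOut (ne ∘ sym)
          = any-true i∈ (cong₂ _∧_ (trans (cong (_==L l u) σ≡) (==L-refl (l u)))
              (cong₂ _∧_ (==E-refl γ) (cong₂ _∧_ (==F-refl x) a)))

        old-adj : ∀ {u w} (ne : u ≢ v) (ne' : w ≢ v) d γ → adj G d u w γ ≡ true → adj G' d (old ne) (old ne') γ ≡ true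
        old-adj ne ne' inD γ a = trans (old-edge ne ne' γ) a
        old-adj ne ne' outD γ a = trans (old-edge ne' ne γ) a

        not-v : ∀ {u} → isNT (l u) ≡ false → u ≢ v
        not-v q refl with () ← trans (sym q) (cong isNT lv)

        -- If the neighbour is the vertex being expanded, `AllHaveInstr` provides an instruction
        -- that reconnects `u`. Its target is no wire-vertex by (W2); if it is a non-terminal, the
        -- clause of (W4) on instructions yields `AllHaveInstr` for the new edge.
        still-attached : ∀ u (q : isNT (l u) ≡ false) W b Y γ d → l u ≡ wire W → l b ≡ nt Y → adj G d u b γ ≡ true →
          AllHaveInstr P Y W γ d → Attached P G' d (old (not-v {u} q))
        still-attached u q W b Y γ d lu lb a all with b Fin.≟ v
        ... | no ne = W , trans (old-lab (not-v {u} q)) lu , old ne , γ , old-adj (not-v {u} q) ne d γ a , inj₂ (Y , trans (old-lab ne) lb , all)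
        ... | yes refl with refl ← trans (sym lv) lb
          with i , i∈ , σ≡ , refl , refl ← all p p∈P refl
          = W , trans (old-lab (not-v {u} q)) lu , ν (Instr.x i) , Instr.γ i , embed (not-v {u} q) i i∈ (trans σ≡ (sym lu)) a , target _ refl
          where
          target : ∀ t → lab D (Instr.x i) ≡ t → isNode (lab G' (ν (Instr.x i))) ≡ true ⊎
            Σ _ λ Y → lab G' (ν (Instr.x i)) ≡ nt Y × AllHaveInstr P Y W (Instr.γ i) (Instr.d i)
          target (node _) lx = inj₁ (cong isNode (trans (ν-lab _) lx))
          target (wire _) lx with () ← trans (sym (ok.w2 i i∈)) (cong isWire lx)
          target (nt Y') lx = inj₂ (Y' , trans (ν-lab _) lx , ok.w4instr i Y' W i∈ lx σ≡)

      applyAt-expansion : Expansion G D G'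
      applyAt-expansion = record
        { extension = record
            { ρ = λ u q → old (not-v {u} q)
            ; ρ-injective = λ {u} {w} {q} {q'} eq →
                FinP.punchOut-injective (not-v {u} q ∘ sym) (not-v {w} q' ∘ sym) (FinP.↑ˡ-injective k _ _ eq)
            ; ρ-lab = λ u q → old-lab (not-v {u} q)
            ; ρ-edge = λ u w q q' γ _ x → trans (old-edge (not-v {u} q) (not-v {w} q') γ) x
            ; ρ-nt = still-attached }
        ; ν = ν ; ν-new = λ x u q eq → ↑ˡ≢↑ʳ (sym eq) ; ν-lab = ν-lab ; ν-edge = ν-edge }

    apply-expansion : ∀ (G : Graph s) v p → lab G v ≡ nt (lhs p) → p ∈ P → ProdOK P p →
      Expansion G (body p) (apply G v p)
    apply-expansion record { n = zero } ()
    apply-expansion record { n = suc m ; lab = l ; edge = e } v p lv p∈ ok = applyAt-expansion l e v p lv p∈ ok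

-- Decoding steps

∨-trueˡ : ∀ {a b} → a ≡ true → a ∨ b ≡ true
∨-trueˡ refl = refl

any-false : ∀ {A : Set} {xs : List A} → foldr _∨_ false (map (λ _ → false) xs) ≡ false
any-false {xs = []}     = refl
any-false {xs = _ ∷ xs} = any-false {xs = xs}

module _ {s : Sig} where

  isWire⇒wire : ∀ {l : Lab s} → isWire l ≡ true → Σ (Fin (Sig.nWire s)) λ W → l ≡ wire W
  isWire⇒wire {wire W} _ = W , refl

  isNT⇒nt : ∀ {l : Lab s} → isNT l ≡ true → Σ (Fin (Sig.nNT s)) λ Y → l ≡ nt Y
  isNT⇒nt {nt Y} _ = Y , refl

  wire-of : ∀ {l : Lab s} → isNode l ≡ false → isNT l ≡ false → isWire l ≡ true
  wire-of {wire _} _ _ = refl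

  module _ (P : List (Production {s})) (G : Graph s) (v w : Fin (n G)) (α : Fin (Sig.nEnc s))
    (N₁ N₂ : Fin (Sig.nNode s)) (lv : lab G v ≡ node N₁) (lw : lab G w ≡ node N₂)
    (r : Rule {s}) (ok : RuleOK α N₁ N₂ r) where
    private
      module ok = RuleOK ok
      module R = IsStringGraph ok.stringGraph
      k = Rule.k r
      G' = decodeAt G v w α r

      neighbour : ∀ b d γ → adj (rhs r) d b zero γ ≡ true →
        (isNode (Rule.rlab r b) ≡ true → adj (rhs r) d b zero γ ≡ false) → Σ (Fin k) λ x → Σ (ELab s) λ γ → Σ Dir λ d →
          adj (rhs r) d (suc (suc x)) zero γ ≡ true × isWire (Rule.rlab r (suc (suc x))) ≡ true
      neighbour zero d γ e no' with () ← trans (sym e) (no' (cong isNode ok.lab0))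
      neighbour (suc zero) d γ e no' with () ← trans (sym e) (no' (cong isNode ok.lab1))
      neighbour (suc (suc x)) d γ e no' = x , γ , d , e ,
        wire-of (BoolP.¬-not λ nb → case trans (sym e) (no' nb) of λ ()) (R.terminal (suc (suc x)))

    decode-lab : ∀ u → lab G' (u ↑ˡ k) ≡ lab G u
    decode-lab u rewrite FinP.splitAt-↑ˡ (n G) u k = refl

    private
      -- the deleted edge joins two node-vertices
      kept : ∀ u u' γ → isWire (lab G u) ≡ true ⊎ isWire (lab G u') ≡ true →
        ((u ==F v) ∧ (u' ==F w) ∧ (γ ==E enc {s = s} α)) ≡ false
      kept u u' γ wr = BoolP.¬-not λ x → joins-nodes wr
          (==F-sound u v (BoolP.∧-conicalˡ _ _ x))
          (==F-sound u' w (BoolP.∧-conicalˡ _ (γ ==E enc α) (BoolP.∧-conicalʳ (u ==F v) _ x)))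
        where
        is-node : ∀ {x N} → lab G x ≡ node N → ¬ isWire (lab G x) ≡ true
        is-node lx wx with () ← trans (sym wx) (cong isWire lx)
        joins-nodes : isWire (lab G u) ≡ true ⊎ isWire (lab G u') ≡ true → u ≡ v → ¬ u' ≡ w
        joins-nodes (inj₁ wu) refl _ = is-node lv wu
        joins-nodes (inj₂ wu') _ refl = is-node lw wu'

    decode-edge : ∀ u u' γ → isWire (lab G u) ≡ true ⊎ isWire (lab G u') ≡ true →
      edge G u u' γ ≡ true → edge G' (u ↑ˡ k) (u' ↑ˡ k) γ ≡ true
    decode-edge u u' γ wr e
      rewrite FinP.splitAt-↑ˡ (n G) u k | FinP.splitAt-↑ˡ (n G) u' k =
      ∨-trueˡ (cong₂ (λ a b → a ∧ not b) e (kept u u' γ wr))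

    decode-extension : Extension P G G'
    decode-extension = record
      { ρ = λ u _ → u ↑ˡ k
      ; ρ-injective = λ eq → FinP.↑ˡ-injective k _ _ eq
      ; ρ-lab = λ u _ → decode-lab u
      ; ρ-edge = λ u u' _ _ γ → decode-edge u u' γ
      ; ρ-nt = λ u _ W b Y γ d lu lb a all → W , trans (decode-lab u) lu , b ↑ˡ k , γ
                 , decode-adj u b γ d (cong isWire lu) a , inj₂ (Y , trans (decode-lab b) lb , all) }
      where
      decode-adj : ∀ u b γ d → isWire (lab G u) ≡ true → adj G d u b γ ≡ true → adj G' d (u ↑ˡ k) (b ↑ˡ k) γ ≡ true
      decode-adj u b γ inD wu = decode-edge u b γ (inj₁ wu)
      decode-adj u b γ outD wu = decode-edge b u γ (inj₂ wu)

    decode-new-adj : ∀ x γ d → adj (rhs r) d (suc (suc x)) zero γ ≡ true → adj G' d (n G ↑ʳ x) (v ↑ˡ k) γ ≡ true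
    decode-new-adj x γ inD e
      rewrite FinP.splitAt-↑ʳ (n G) k x
            | dec-false (v ↑ˡ k Fin.≟ n G ↑ʳ x) ↑ˡ≢↑ʳ | dec-false (w ↑ˡ k Fin.≟ n G ↑ʳ x) ↑ˡ≢↑ʳ =
      -- The two leading disjuncts belong to the interface vertices, which are old and hence not the
      -- source of this edge. The new vertex `x` is found in `tail`.
      cong₂ _∨_ (any-false {xs = tail}) (cong₂ _∨_ (any-false {xs = tail}) (any-true {xs = tail} (∈-tabulate⁺ x)
        (∨-trueˡ (cong₂ _∧_ (==F-refl (n G ↑ʳ x)) (cong₂ _∧_ (==F-refl (v ↑ˡ k)) e)))))
      where
      tail : List (Fin (suc (suc k)))
      tail = tabulate (λ y → suc (suc y))
    decode-new-adj x γ outD e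
      rewrite FinP.splitAt-↑ˡ (n G) v k | FinP.splitAt-↑ʳ (n G) k x
            | dec-false (v ↑ˡ k Fin.≟ n G ↑ʳ x) ↑ˡ≢↑ʳ | dec-false (w ↑ˡ k Fin.≟ n G ↑ʳ x) ↑ˡ≢↑ʳ
            | dec-true (v ↑ˡ k Fin.≟ v ↑ˡ k) refl =
      ∨-trueˡ (any-true {xs = tabulate (λ (y : Fin k) → suc {suc k} (suc y))} (∈-tabulate⁺ x)
        (cong₂ _∧_ (==F-refl (n G ↑ʳ x)) e))

    -- Node-vertices are not adjacent in the connected right-hand side, so the first one has a wire-vertex neighbour.
    decode-end : Σ (Fin k) λ x → Σ (ELab s) λ γ → Σ Dir λ d →
      adj (rhs r) d (suc (suc x)) zero γ ≡ true × isWire (Rule.rlab r (suc (suc x))) ≡ true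
    decode-end with ok.connected zero (suc zero)
    ... | fwd {b = b} γ e _ = neighbour b outD γ e (R.noNodeNode zero b γ (cong isNode ok.lab0))
    ... | bwd {b = b} γ e _ = neighbour b inD γ e (λ nb → R.noNodeNode b zero γ nb (cong isNode ok.lab0))

    -- The new wire-vertex is marked as an end; the node-vertex beside it is the interface vertex
    -- `v`, which the step keeps.
    decode-marks : ∀ {j} → Marks P G j → Marks P G' (suc j)
    decode-marks M with decode-end
    ... | x , γ , d , e , wx with isWire⇒wire wx
    ...   | W , lx = extend P decode-extension M (λ u _ p → ↑ˡ≢↑ʳ (sym p))
      (end {d = d} (W , trans new-lab lx , v ↑ˡ k , γ , decode-new-adj x γ d e
                   , inj₁ (cong isNode (trans (decode-lab v) lv))))
      where
      new-lab : lab G' (n G ↑ʳ x) ≡ Rule.rlab r (suc (suc x))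
      new-lab rewrite FinP.splitAt-↑ʳ (n G) k x = refl

  decode-steps : ∀ P (T : DecSys {s}) → (∀ α N₁ N₂ → RuleOK α N₁ N₂ (T α N₁ N₂)) →
    ∀ ds G {K j} → Marks P G j → runT T G ds ≡ just K → Σ ℕ λ j' → Marks P K j' × length ds + j ≤ j'
  decode-steps P T ok [] G M refl = _ , M , ℕₚ.≤-refl
  decode-steps P T ok ((v , w , a) ∷ ds) G {K} {j} M eq
    with toFin? {s} (n G) v | toFin? {s} (n G) w | toFin? {s} (Sig.nEnc s) a
  ... | just v' | just w' | just α with lab G v' in lv | lab G w' in lw
  ...   | node N₁ | node N₂ with edge G v' w' (enc α)
  ...     | true with decode-steps P T ok ds _ (decode-marks P G v' w' α N₁ N₂ lv lw (T α N₁ N₂) (ok α N₁ N₂) M) eq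
  ...       | j' , M' , le = j' , M' , ℕₚ.≤-trans (ℕₚ.≤-reflexive (sym (ℕₚ.+-suc (length ds) j))) le

-- Production bodies

injective⇒surjective : ∀ {n} {f : Fin n → Fin n} → (∀ {a b} → f a ≡ f b → a ≡ b) → ∀ y → Σ (Fin n) λ x → f x ≡ y
injective⇒surjective {suc n} {f} inj y with FinP.any? (λ x → f x Fin.≟ y)
... | yes p = p
... | no ¬p = ⊥-elim (ℕₚ.1+n≰n (FinP.injective⇒≤ {f = λ x → punchOut (missed x)}
                (λ {a} {b} eq → inj (FinP.punchOut-injective (missed a) (missed b) eq))))
  where
  missed : ∀ x → y ≢ f x
  missed x p = ¬p (x , sym p)

module _ {s : Sig} where

  -- Following the successors of a wire-vertex without predecessor yields a bare wire,
  -- provided that wire-vertices are adjacent to wire-vertices only.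
  module Walk (D : Graph s) (deg : WireDeg≤1 D)
    (next-wire : ∀ a b γ → isWire (lab D a) ≡ true → edge D a b γ ≡ true → isWire (lab D b) ≡ true)
    (prev-wire : ∀ a b γ → isWire (lab D b) ≡ true → edge D a b γ ≡ true → isWire (lab D a) ≡ true)
    (start : Fin (n D)) (wire-start : isWire (lab D start) ≡ true)
    (no-prev : ∀ b γ → edge D b start γ ≡ false) where

    HasNext : Fin (n D) → Set
    HasNext v = Σ (Fin (n D)) λ b → Σ (ELab s) λ γ → edge D v b γ ≡ true

    hasNext? : ∀ v → Dec (HasNext v)
    hasNext? v = FinP.any? λ b → any-elab? λ γ → edge D v b γ Bool.≟ true

    succ : Fin (n D) → Fin (n D)
    succ v with hasNext? v
    ... | yes (b , _) = b
    ... | no _        = v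

    succ-edge : ∀ {v} → HasNext v → Σ (ELab s) λ γ → edge D v (succ v) γ ≡ true
    succ-edge {v} h with hasNext? v
    ... | yes (_ , e) = e
    ... | no ¬h       = ⊥-elim (¬h h)

    at : ℕ → Fin (n D)
    at zero    = start
    at (suc i) = succ (at i)

    Path : ℕ → Set
    Path j = ∀ i → i < j → HasNext (at i)

    at-wire : ∀ {j} → Path j → ∀ i → i ≤ j → isWire (lab D (at i)) ≡ true
    at-wire p zero _ = wire-start
    at-wire p (suc i) lt = let γ , e = succ-edge (p i lt) in
      next-wire _ _ γ (at-wire p i (ℕₚ.<⇒≤ lt)) e

    -- By uniqueness of predecessors a repetition can be traced back to a return to `start`, which
    -- has no predecessor.
    at-distinct : ∀ {j} → Path j → ∀ a b → a < b → b ≤ j → at a ≢ at b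
    at-distinct p zero (suc b) lt le eq
      with γ , e ← succ-edge (p b le)
      with () ← trans (sym (no-prev _ γ)) (trans (cong (λ x → edge D (at b) x γ) eq) e)
    at-distinct p (suc a) (suc b) (s≤s lt) le eq
      with γ , e ← succ-edge (p a (ℕₚ.<-trans lt le)) | δ , e' ← succ-edge (p b le)
      = at-distinct p a b lt (ℕₚ.<⇒≤ le)
          (proj₁ (proj₁ (deg _ (at-wire p (suc b) le)) _ _ γ δ (trans (cong (λ x → edge D (at a) x γ) (sym eq)) e) e'))

    at-injective : ∀ {j} → Path j → ∀ {a b} → a ≤ j → b ≤ j → at a ≡ at b → a ≡ b
    at-injective p {a} {b} la lb eq with ℕₚ.<-cmp a b
    ... | tri< lt _ _ = ⊥-elim (at-distinct p a b lt lb eq)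
    ... | tri≈ _ q _  = q
    ... | tri> _ _ gt = ⊥-elim (at-distinct p b a gt la (sym eq))

    path-bound : ∀ {j} → Path j → suc j ≤ n D
    path-bound {j} p = FinP.injective⇒≤ {f = λ i → at (toℕ i)}
      (λ {a} {b} eq → FinP.toℕ-injective
        (at-injective p (ℕ.s≤s⁻¹ (FinP.toℕ<n a)) (ℕ.s≤s⁻¹ (FinP.toℕ<n b)) eq))

    extend-path : ∀ {j} → Path j → HasNext (at j) → Path (suc j)
    extend-path p h i lt with ℕₚ.m≤n⇒m<n∨m≡n (ℕ.s≤s⁻¹ lt)
    ... | inj₁ lt' = p i lt'
    ... | inj₂ refl = h

    maximal-path : ∀ k j → k + j ≡ n D → Path j → Σ ℕ λ l → j ≤ l × Path l × ¬ HasNext (at l)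
    maximal-path k j eq p with hasNext? (at j)
    ... | no ¬h = j , ℕₚ.≤-refl , p , ¬h
    -- A path of `n D` steps would visit `n D + 1` distinct vertices.
    maximal-path zero j refl p | yes h = ⊥-elim (ℕₚ.1+n≰n (path-bound p))
    maximal-path (suc k) j eq p | yes h =
      let l , le , q , ¬h = maximal-path k (suc j) (trans (ℕₚ.+-suc k j) eq) (extend-path p h)
      in l , ℕₚ.<⇒≤ le , q , ¬h

    bareWire : HasNext start → BareWire D
    -- Beginning with a path of one step guarantees the edge that a bare wire must contain, so the
    -- final length is a successor.
    bareWire h with maximal-path (n D ℕ.∸ 1) 1 pred+1 (extend-path {0} (λ _ ()) h)
      where
      pred+1 : n D ℕ.∸ 1 + 1 ≡ n D
      pred+1 = ℕₚ.m∸n+n≡m (ℕₚ.≤-trans (s≤s z≤n) (FinP.toℕ<n start))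
    ... | suc l , _ , p , ¬h = record
      { len = l
      ; vs = λ i → at (toℕ i)
      ; distinct = λ i j eq → FinP.toℕ-injective (at-injective p (le i) (le j) eq)
      ; wires = λ i → wires i
      ; chain = λ i → subst (λ x → Σ (ELab s) λ γ → edge D (at x) (at (suc (toℕ i))) γ ≡ true) (sym (FinP.toℕ-inject₁ i))
                        (succ-edge (p (toℕ i) (FinP.toℕ<n i)))
      ; startMax = λ b γ _ → no-prev b γ
      ; endMax = λ b γ _ → BoolP.¬-not λ e → ¬h (b , γ ,
          trans (cong (λ x → edge D x b γ) (cong at (sym (FinP.toℕ-fromℕ (suc l))))) e)
      ; noNodeOut = λ i b γ nb → BoolP.¬-not λ e → node≢wire nb (next-wire _ b γ (wires i) e)
      ; noNodeIn = λ i b γ nb → BoolP.¬-not λ e → node≢wire nb (prev-wire b _ γ (wires i) e) }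
      where
      le : ∀ (i : Fin (suc (suc l))) → toℕ i ≤ suc l
      le i = ℕ.s≤s⁻¹ (FinP.toℕ<n i)
      wires : ∀ (i : Fin (suc (suc l))) → isWire (lab D (at (toℕ i))) ≡ true
      wires i = at-wire p (toℕ i) (le i)

  -- The predecessor map, extended by the identity to the other vertices, is injective by the
  -- out-degree bound. On a finite set it is then surjective, which gives every wire-vertex a
  -- successor.
  all-wires-circle : ∀ (D : Graph s) → WireDeg≤1 D →
    (∀ b → isWire (lab D b) ≡ true →
      Σ (Fin (n D)) λ a → Σ (ELab s) λ γ → isWire (lab D a) ≡ true × edge D a b γ ≡ true) →
    Circle D (λ v → isWire (lab D v) ≡ true)
  all-wires-circle D deg has-prev = record { wires = id ; next = next ; prev = λ {v} → has-prev v }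
    where
    pred : Fin (n D) → Fin (n D)
    pred v with isWire? (lab D v)
    ... | yes w = proj₁ (has-prev v w)
    ... | no _  = v
    pred-injective : ∀ {a b} → pred a ≡ pred b → a ≡ b
    pred-injective {a} {b} eq with isWire? (lab D a) | isWire? (lab D b)
    ... | yes wa | yes wb =
      let a' , γ , wa' , e = has-prev a wa
          b' , δ , _ , e' = has-prev b wb
      in proj₁ (proj₂ (deg a' wa') _ _ γ δ e (trans (cong (λ x → edge D x b δ) eq) e'))
    ... | yes wa | no nb = let _ , _ , wa' , _ = has-prev a wa in ⊥-elim (nb (trans (cong (isWire ∘ lab D) (sym eq)) wa'))
    ... | no na | yes wb = let _ , _ , wb' , _ = has-prev b wb in ⊥-elim (na (trans (cong (isWire ∘ lab D) eq) wb'))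
    ... | no _ | no _ = eq
    next : ∀ {v} → isWire (lab D v) ≡ true →
      Σ (Fin (n D)) λ w → Σ (ELab s) λ γ → isWire (lab D w) ≡ true × edge D v w γ ≡ true
    next {v} wv with w , eq ← injective⇒surjective pred-injective v with isWire? (lab D w)
    ... | yes ww = let a , γ , _ , e = has-prev w ww in w , γ , ww , trans (cong (λ x → edge D x w γ) (sym eq)) e
    ... | no nw  = ⊥-elim (nw (subst (λ x → isWire (lab D x) ≡ true) (sym eq) wv))

  data BodyClass (P : List (Production {s})) (D : Graph s) : Set₁ where
    marked : ∀ {t x} → Good P D (λ _ → ⊥) t x → BodyClass P D
    bare   : BareWire D → BodyClass P D
    many   : 2 ≤ countNT D → BodyClass P D

  countNT-all : ∀ {m} (l : Fin m → Lab s) → (∀ a → isNT (l a) ≡ true) → sum (λ a → ntWeight (l a)) ≡ m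
  countNT-all {zero} l all = refl
  countNT-all {suc m} l all rewrite all zero = cong suc (countNT-all (l ∘ suc) (all ∘ suc))

  -- Once node-vertices and attachments to non-terminals are excluded, wire-vertices have only
  -- wire-vertices as neighbours. One without predecessor is not isolated and starts a bare wire; if
  -- there is none, all wire-vertices lie on closed wires. Without wire-vertices the body has
  -- non-terminals only, at least two because it is neither empty nor a single one.
  classify : ∀ (P : List (Production {s})) p → ProdOK P p →
    (∀ a → isWire (lab (body p) a) ≡ true → Σ (Fin (n (body p))) λ b → Σ (ELab s) λ γ →
      (edge (body p) a b γ ≡ true) ⊎ (edge (body p) b a γ ≡ true)) →
    n (body p) ≢ 0 → ¬ ((n (body p) ≡ 1) × (∀ a → isNT (lab (body p) a) ≡ true)) → BodyClass P (body p)
  classify P p ok noIso nonEmpty notSingle = nodes (FinP.any? λ x → isNode (lab D x) Bool.≟ true)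
    where
    module ok = ProdOK ok
    D = body p

    deg : WireDeg≤1 D
    deg v w = ok.w1in v w , ok.w1out v w

    NTAdjacent Source : Set
    NTAdjacent = Σ (Fin (n D)) λ a → isWire (lab D a) ≡ true ×
      Σ (Fin (n D)) λ b → Σ (ELab s) λ γ → isNT (lab D b) ≡ true × (edge D a b γ ≡ true ⊎ edge D b a γ ≡ true)
    Source = Σ (Fin (n D)) λ a → isWire (lab D a) ≡ true × (∀ b γ → edge D b a γ ≡ false)

    ntAdjacent? : Dec NTAdjacent
    ntAdjacent? = FinP.any? λ a → isWire? (lab D a) ×-dec FinP.any? λ b → any-elab? λ γ →
      (isNT (lab D b) Bool.≟ true) ×-dec ((edge D a b γ Bool.≟ true) ⊎-dec (edge D b a γ Bool.≟ true))

    source? : Dec Source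
    source? = FinP.any? λ a → isWire? (lab D a) ×-dec FinP.all? λ b → all-elab? λ γ → edge D b a γ Bool.≟ false

    module _ (noNode : ∀ x → isNode (lab D x) ≡ false) where
      wires-only : (∀ a → isWire (lab D a) ≡ false) → BodyClass P D
      wires-only noWire = many (subst (2 ≤_) (sym (countNT-all (lab D) allNT)) (two-≤ (n D) refl))
        where
        allNT : ∀ a → isNT (lab D a) ≡ true
        allNT a = nt-of (noNode a) (noWire a)
          where
          nt-of : ∀ {l : Lab s} → isNode l ≡ false → isWire l ≡ false → isNT l ≡ true
          nt-of {nt _} _ _ = refl
        two-≤ : ∀ m → n D ≡ m → 2 ≤ m
        two-≤ 0 eq = ⊥-elim (nonEmpty eq)
        two-≤ 1 eq = ⊥-elim (notSingle (eq , allNT))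
        two-≤ (suc (suc m)) _ = s≤s (s≤s z≤n)

      module _ (noAdj : ∀ a b γ → isWire (lab D a) ≡ true → edge D a b γ ≡ true ⊎ edge D b a γ ≡ true → isNT (lab D b) ≡ false) where
        neighbour-wire : ∀ a b γ → isWire (lab D a) ≡ true → edge D a b γ ≡ true ⊎ edge D b a γ ≡ true → isWire (lab D b) ≡ true
        neighbour-wire a b γ w e = wire-of (noNode b) (noAdj a b γ w e)

        sources : Dec Source → BodyClass P D
        sources (yes (a , wa , no-prev)) = bare (Walk.bareWire D deg
          (λ a b γ w e → neighbour-wire a b γ w (inj₁ e)) (λ a b γ w e → neighbour-wire b a γ w (inj₂ e))
          a wa no-prev (has-next (noIso a wa)))
          where
          has-next : (Σ (Fin (n D)) λ b → Σ (ELab s) λ γ → edge D a b γ ≡ true ⊎ edge D b a γ ≡ true) →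
            Σ (Fin (n D)) λ b → Σ (ELab s) λ γ → edge D a b γ ≡ true
          has-next (b , γ , inj₁ e) = b , γ , e
          has-next (b , γ , inj₂ e) with () ← trans (sym (no-prev b γ)) e
        sources (no ¬p) with FinP.any? (λ a → isWire? (lab D a))
        ... | no noWire = wires-only λ a → BoolP.¬-not λ w → noWire (a , w)
        ... | yes (a , wa) = marked (circle {u = a} _ (all-wires-circle D deg has-prev) wa λ ())
          where
          has-prev : ∀ b → isWire (lab D b) ≡ true →
            Σ (Fin (n D)) λ a → Σ (ELab s) λ γ → isWire (lab D a) ≡ true × edge D a b γ ≡ true
          has-prev b wb with FinP.any? (λ a → any-elab? (λ γ → edge D a b γ Bool.≟ true))
          ... | yes (a , γ , e) = a , γ , neighbour-wire b a γ wb (inj₂ e) , e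
          ... | no ¬e = ⊥-elim (¬p (b , wb , λ a γ → BoolP.¬-not λ e → ¬e (a , γ , e)))

      adjacent : Dec NTAdjacent → BodyClass P D
      adjacent (yes (a , wa , b , γ , ntb , e)) with isWire⇒wire wa | isNT⇒nt ntb | e
      ... | W , la | Y , lb | inj₁ e =
        marked (end {d = inD} (W , la , b , γ , e , inj₂ (Y , lb , ok.w4in b Y a W γ lb la e)))
      ... | W , la | Y , lb | inj₂ e =
        marked (end {d = outD} (W , la , b , γ , e , inj₂ (Y , lb , ok.w4out b Y a W γ lb la e)))
      adjacent (no ¬p) = sources (λ a b γ w e → BoolP.¬-not λ ntb → ¬p (a , w , b , γ , ntb , e)) source?

    nodes : Dec (Σ (Fin (n D)) λ x → isNode (lab D x) ≡ true) → BodyClass P D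
    nodes (yes (x , nd)) = marked (vertex nd)
    nodes (no ¬p) = adjacent (λ x → BoolP.¬-not λ nd → ¬p (x , nd)) ntAdjacent?

-- Lengths of derivations

sum-mono : ∀ {m} {f g : Fin m → ℕ} → (∀ i → f i ≤ g i) → sum f ≤ sum g
sum-mono {zero} le = z≤n
sum-mono {suc m} le = ℕₚ.+-mono-≤ (le zero) (sum-mono (le ∘ suc))

sum-mono-< : ∀ {m} {f g : Fin m → ℕ} → (∀ i → f i ≤ g i) → ∀ j → f j < g j → sum f < sum g
sum-mono-< le zero lt = ℕₚ.+-mono-<-≤ lt (sum-mono (le ∘ suc))
sum-mono-< le (suc j) lt = ℕₚ.+-mono-≤-< (le zero) (sum-mono-< (le ∘ suc) j lt)

sum-zero : ∀ {m} {f : Fin m → ℕ} → (∀ i → f i ≡ 0) → sum f ≡ 0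
sum-zero {zero} z = refl
sum-zero {suc m} z = cong₂ _+_ (z zero) (sum-zero (z ∘ suc))

module _ {s : Sig} where

  nth-∈ : ∀ {A : Set} (xs : List A) i {x} → nth {s} xs i ≡ just x → x ∈ xs
  nth-∈ (y ∷ xs) zero refl = here refl
  nth-∈ (y ∷ xs) (suc i) e = there (nth-∈ xs i e)

  nth-index : ∀ {A : Set} (xs : List A) i {x} → nth {s} xs i ≡ just x → i < length xs
  nth-index (y ∷ xs) zero e = s≤s z≤n
  nth-index (y ∷ xs) (suc i) e = s≤s (nth-index xs i e)

  uses-≤ : ∀ i c gs → uses {s} i gs ≤ uses {s} i (c ∷ gs)
  uses-≤ i c gs with proj₂ c ℕ.≡ᵇ i
  ... | true  = ℕₚ.n≤1+n _
  ... | false = ℕₚ.≤-refl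

  uses-< : ∀ i v gs → uses {s} i gs < uses {s} i ((v , i) ∷ gs)
  uses-< i v gs rewrite dec-true (i ℕ.≟ i) refl = ℕₚ.≤-refl

  NTFree⇒countNT≡0 : ∀ (G : Graph s) → NTFree G ≡ true → countNT G ≡ 0
  NTFree⇒countNT≡0 G free = sum-zero (λ a → cong (λ b → if b then 1 else 0) (BoolP.¬-not λ e →
    case trans (sym free) (cong not (any-true {f = λ v → isNT (lab G v)} (∈-allFin a) e)) of λ ()))

  runG-∷ : ∀ (P : List (Production {s})) G v i gs {H} → runG P G ((v , i) ∷ gs) ≡ just H →
    Σ (Fin (n G)) λ v' → Σ Production λ p → toFin? {s} (n G) v ≡ just v' × nth {s} P i ≡ just p ×
      lab G v' ≡ nt (lhs p) × runG P (apply G v' p) gs ≡ just H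
  runG-∷ P G v i gs eq with toFin? {s} (n G) v | nth {s} P i
  ... | just v' | just p with lab G v' ==L nt (lhs p) in l
  ...   | true = v' , p , refl , refl , ==L-sound _ _ l , eq

  module StepBound (B : ESG {s}) (isB : IsBESG B) (me : MatchExhaustive B) where
    open ESG B
    open MatchExhaustive me using (bareBounded; noIsolatedWire; nonEmpty; notSingleNT)

    class : ∀ p → p ∈ P → BodyClass P (body p)
    class p p∈ = classify P p (IsBESG.prods isB p p∈) (noIsolatedWire p p∈) (nonEmpty p p∈) (notSingleNT p p∈)

    -- nothing if steps with the i-th production are accounted for by marks or by the number of non-terminals
    bareBound′ : ∀ i m → nth {s} P i ≡ m → Maybe ℕ
    bareBound′ i nothing e = nothing
    bareBound′ i (just p) e with class p (nth-∈ P i e)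
    ... | bare w = just (proj₁ (bareBounded i p e w))
    ... | _      = nothing

    bareBound : ℕ → Maybe ℕ
    bareBound i = bareBound′ i (nth {s} P i) refl

    bareUses : List (ℕ × ℕ) → ℕ → ℕ
    bareUses gs i = maybe (λ _ → uses {s} i gs) 0 (bareBound i)

    totalBare : List (ℕ × ℕ) → ℕ
    totalBare gs = sum {length P} (bareUses gs ∘ toℕ)

    maxBare : ℕ
    maxBare = sum {length P} (maybe id 0 ∘ bareBound ∘ toℕ)

    -- The assumed bounds concern derivations from the start graph. The induction in
    -- `derivation-steps` passes through arbitrary graphs, so it keeps `totalBare` as it is, and the
    -- bound is inserted only for the whole derivation.
    totalBare≤ : ∀ {gs H} → runG P (startGraph S) gs ≡ just H → totalBare gs ≤ maxBare
    totalBare≤ {gs} {H} run = sum-mono {length P} (λ j → each (toℕ j) _ refl)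
      where
      each : ∀ i m e → maybe (λ _ → uses {s} i gs) 0 (bareBound′ i m e) ≤ maybe id 0 (bareBound′ i m e)
      each i nothing e = z≤n
      each i (just p) e with class p (nth-∈ P i e)
      ... | bare w = proj₂ (bareBounded i p e w) gs H run
      ... | marked _ = z≤n
      ... | many _ = z≤n

    totalBare-∷ : ∀ c gs → totalBare gs ≤ totalBare (c ∷ gs)
    totalBare-∷ c gs = sum-mono {length P} (λ j → each (toℕ j))
      where
      each : ∀ i → bareUses gs i ≤ bareUses (c ∷ gs) i
      each i with bareBound i
      ... | just _ = uses-≤ i c gs
      ... | nothing = z≤n

    totalBare-bare : ∀ v i gs {p b} → nth {s} P i ≡ just p → bareBound i ≡ just b →
      totalBare gs < totalBare ((v , i) ∷ gs)
    totalBare-bare v i gs e eb = sum-mono-< {length P} (λ j → each (toℕ j)) j strict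
      where
      each : ∀ i' → bareUses gs i' ≤ bareUses ((v , i) ∷ gs) i'
      each i' with bareBound i'
      ... | just _ = uses-≤ i' (v , i) gs
      ... | nothing = z≤n
      j : Fin (length P)
      j = Fin.fromℕ< (nth-index P i e)
      strict : bareUses gs (toℕ j) < bareUses ((v , i) ∷ gs) (toℕ j)
      strict rewrite FinP.toℕ-fromℕ< (nth-index P i e) | eb = uses-< i v gs

    bareBound-bare : ∀ i {p w} (e : nth {s} P i ≡ just p) → class p (nth-∈ P i e) ≡ bare w →
      Σ ℕ λ b → bareBound i ≡ just b
    bareBound-bare i {p} {w} e c = _ , trans (generalize _ e) computed
      -- `bareBound i` performs its lookup with the proof `refl`. Generalizing over the result of
      -- the lookup trades this proof for `e`, after which the class of `p` is visible.
      where
      generalize : ∀ m e → bareBound′ i (nth {s} P i) refl ≡ bareBound′ i m e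
      generalize _ refl = refl
      computed : bareBound′ i (just p) e ≡ just (proj₁ (bareBounded i p e w))
      computed rewrite c = refl

    -- A step either adds a mark, or uses a bare-wire production, or increases the number of non-terminals,
    -- which any other step decreases by at most one.
    derivation-steps : ∀ gs G {H k} → Marks P G k → runG P G gs ≡ just H →
      Σ ℕ λ k' → Marks P H k' × length gs + countNT G + 2 * k ≤ 2 * (k' + totalBare gs) + countNT H
    derivation-steps [] G {k = k} M refl = k , M ,
      ℕₚ.≤-trans (ℕₚ.≤-reflexive (ℕₚ.+-comm (countNT G) (2 * k)))
        (ℕₚ.+-monoˡ-≤ (countNT G) (ℕₚ.*-monoʳ-≤ 2 (ℕₚ.m≤m+n k _)))
    derivation-steps ((v , i) ∷ gs) G {H} {k} M eq
      with v' , p , _ , e , lv , run ← runG-∷ P G v i gs eq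
      = by-class (class p (nth-∈ P i e)) refl
      where
      G' = apply G v' p
      p∈ = nth-∈ P i e
      E = apply-expansion P G v' p lv p∈ (IsBESG.prods isB p p∈)
      x = Expansion.extension E
      -- The factor 2 pays for the step itself and for the one non-terminal that a marking or
      -- bare-wire step may consume. A step with at least two new non-terminals pays for itself by
      -- raising `countNT`.
      Goal = Σ ℕ λ k' → Marks P H k' ×
        suc (length gs) + countNT G + 2 * k ≤ 2 * (k' + totalBare ((v , i) ∷ gs)) + countNT H
      count : suc (countNT G') ≡ countNT G + countNT (body p)
      count = countNT-apply G v' p (cong isNT lv)
      count≤ : countNT G ≤ suc (countNT G')
      count≤ = ℕₚ.≤-trans (ℕₚ.m≤m+n _ _) (ℕₚ.≤-reflexive (sym count))
      open ℕₚ.≤-Reasoning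
      by-class : ∀ c → class p p∈ ≡ c → Goal
      by-class (marked g) _
        with k' , M' , le ← derivation-steps gs G' (extend P x M (Expansion.ν-new E _) (good-body P E g)) run =
        k' , M' , (begin
          suc (length gs) + countNT G + 2 * k ≤⟨ ℕₚ.+-monoˡ-≤ (2 * k) (ℕₚ.+-monoʳ-≤ (suc (length gs)) count≤) ⟩
          suc (length gs) + suc (countNT G') + 2 * k ≡⟨ arith (length gs) (countNT G') k ⟩
          length gs + countNT G' + 2 * suc k ≤⟨ le ⟩
          2 * (k' + totalBare gs) + countNT H
            ≤⟨ ℕₚ.+-monoˡ-≤ (countNT H) (ℕₚ.*-monoʳ-≤ 2 (ℕₚ.+-monoʳ-≤ k' (totalBare-∷ (v , i) gs))) ⟩
          2 * (k' + totalBare ((v , i) ∷ gs)) + countNT H ∎)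
        where
        open +-*-Solver
        arith : ∀ a b c → suc a + suc b + 2 * c ≡ a + b + 2 * suc c
        arith = solve 3 (λ a b c → (con 1 :+ a) :+ (con 1 :+ b) :+ con 2 :* c := a :+ b :+ con 2 :* (con 1 :+ c)) refl
      by-class (bare w) c with k' , M' , le ← derivation-steps gs G' (carry P x M) run =
        k' , M' , (begin
          suc (length gs) + countNT G + 2 * k ≤⟨ ℕₚ.+-monoˡ-≤ (2 * k) (ℕₚ.+-monoʳ-≤ (suc (length gs)) count≤) ⟩
          suc (length gs) + suc (countNT G') + 2 * k ≡⟨ arith (length gs) (countNT G') k ⟩
          2 + (length gs + countNT G' + 2 * k) ≤⟨ ℕₚ.+-monoʳ-≤ 2 le ⟩
          2 + (2 * (k' + totalBare gs) + countNT H) ≡⟨ arith' k' (totalBare gs) (countNT H) ⟩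
          2 * (k' + suc (totalBare gs)) + countNT H
            ≤⟨ ℕₚ.+-monoˡ-≤ (countNT H) (ℕₚ.*-monoʳ-≤ 2 (ℕₚ.+-monoʳ-≤ k'
                 (totalBare-bare v i gs e (proj₂ (bareBound-bare i e c))))) ⟩
          2 * (k' + totalBare ((v , i) ∷ gs)) + countNT H ∎)
        where
        open +-*-Solver
        arith : ∀ a b c → suc a + suc b + 2 * c ≡ 2 + (a + b + 2 * c)
        arith = solve 3 (λ a b c → (con 1 :+ a) :+ (con 1 :+ b) :+ con 2 :* c := con 2 :+ (a :+ b :+ con 2 :* c)) refl
        arith' : ∀ a b c → 2 + (2 * (a + b) + c) ≡ 2 * (a + suc b) + c
        arith' = solve 3 (λ a b c → con 2 :+ (con 2 :* (a :+ b) :+ c) := con 2 :* (a :+ (con 1 :+ b)) :+ c) refl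
      by-class (many two) _ with k' , M' , le ← derivation-steps gs G' (carry P x M) run =
        k' , M' , (begin
          suc (length gs) + countNT G + 2 * k ≡⟨ cong (_+ 2 * k) (sym (ℕₚ.+-suc (length gs) (countNT G))) ⟩
          length gs + suc (countNT G) + 2 * k ≤⟨ ℕₚ.+-monoˡ-≤ (2 * k) (ℕₚ.+-monoʳ-≤ (length gs) more) ⟩
          length gs + countNT G' + 2 * k ≤⟨ le ⟩
          2 * (k' + totalBare gs) + countNT H
            ≤⟨ ℕₚ.+-monoˡ-≤ (countNT H) (ℕₚ.*-monoʳ-≤ 2 (ℕₚ.+-monoʳ-≤ k' (totalBare-∷ (v , i) gs))) ⟩
          2 * (k' + totalBare ((v , i) ∷ gs)) + countNT H ∎)
        where
        more : suc (countNT G) ≤ countNT G'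
        more = ℕ.s≤s⁻¹ (begin
          2 + countNT G ≡⟨ ℕₚ.+-comm 2 (countNT G) ⟩
          countNT G + 2 ≤⟨ ℕₚ.+-monoʳ-≤ (countNT G) two ⟩
          countNT G + countNT (body p) ≡⟨ sym count ⟩
          suc (countNT G') ∎)

    concrete-inv : ∀ gs ds {K} → concrete B (gs , ds) ≡ just K →
      Σ (Graph s) λ G → runG P (startGraph S) gs ≡ just G × NTFree G ≡ true × runT T G ds ≡ just K
    concrete-inv gs ds eq with runG P (startGraph S) gs
    ... | just G with NTFree G in free
    ...   | true = G , refl , free , eq

    -- Marks set by grammar steps survive the decoding, so the one bound on the marks of `K` limits
    -- both the marking grammar steps and the decoding steps.
    length-bound : ∀ gs ds {K H} → IsStringGraph H → concrete B (gs , ds) ≡ just K → HasMatching K H →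
      length gs ≤ 2 * (4 * n H + maxBare) × length ds ≤ 4 * n H
    length-bound gs ds {K} {H} SH eq (H̃ , S̃ , hom , match)
      with G , run , free , dec ← concrete-inv gs ds eq
      with k , M , le ← derivation-steps gs (startGraph S) {k = 0}
             (record { mark = λ () ; injective = λ { {()} } ; tag = λ () ; good = λ () }) run
      with k' , M' , le' ← decode-steps P T (IsBESG.rules isB) ds G M dec
      = gs≤ , ℕₚ.≤-trans (ℕₚ.m≤m+n _ k) (ℕₚ.≤-trans le' k'≤)
      where
      k'≤ : k' ≤ 4 * n H
      k'≤ = marks-bound S̃ match (wireHom⇒corr (Eq.symmetric _ hom)) M'
      k≤ : k ≤ 4 * n H
      k≤ = ℕₚ.≤-trans (ℕₚ.m≤n+m k (length ds)) (ℕₚ.≤-trans le' k'≤)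
      open ℕₚ.≤-Reasoning
      gs≤ : length gs ≤ 2 * (4 * n H + maxBare)
      gs≤ = begin
        length gs ≤⟨ ℕₚ.m≤m+n _ _ ⟩
        -- The 1 is the non-terminal of the start graph, and the 0 below comes from its empty family
        -- of marks.
        length gs + 1 ≤⟨ ℕₚ.m≤m+n _ _ ⟩
        length gs + 1 + 0 ≤⟨ le ⟩
        2 * (k + totalBare gs) + countNT G ≡⟨ cong (2 * (k + totalBare gs) +_) (NTFree⇒countNT≡0 G free) ⟩
        2 * (k + totalBare gs) + 0 ≡⟨ ℕₚ.+-identityʳ _ ⟩
        2 * (k + totalBare gs) ≤⟨ ℕₚ.*-monoʳ-≤ 2 (ℕₚ.+-mono-≤ k≤ (totalBare≤ {gs} run)) ⟩
        2 * (4 * n H + maxBare) ∎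

-- Enumeration

∈-concatMap : ∀ {A B : Set} {f : A → List B} {xs x y} → x ∈ xs → y ∈ f x → y ∈ concatMap f xs
∈-concatMap {f = f} x∈ y∈ = ∈-concatMap⁺ f (lose x∈ y∈)

∈-maybe : ∀ {A B : Set} {f : A → List B} {m x y} → m ≡ just x → y ∈ f x → y ∈ maybe f [] m
∈-maybe refl y∈ = y∈

module _ {s : Sig} where

  toFin?-toℕ : ∀ k i {j} → toFin? {s} k i ≡ just j → toℕ j ≡ i
  toFin?-toℕ (suc k) zero refl = refl
  toFin?-toℕ (suc k) (suc i) e with toFin? {s} k i in eq
  toFin?-toℕ (suc k) (suc i) refl | just j = cong suc (toFin?-toℕ k i eq)

  -- Deliberately too generous: the label of the expanded vertex is not compared with the left-hand
  -- side. Every candidate is run again by `matched?`, so only completeness matters here.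
  derivations : List (Production {s}) → ℕ → Graph s → List (List (ℕ × ℕ))
  derivations P zero G = [] ∷ []
  derivations P (suc k) G = [] ∷ concatMap (λ v → concatMap (λ i →
      maybe (λ p → map ((toℕ v , i) ∷_) (derivations P k (apply G v p))) [] (nth {s} P i))
    (upTo (length P))) (allFin (n G))

  ∈-derivations : ∀ P k G gs {H} → runG P G gs ≡ just H → length gs ≤ k → gs ∈ derivations P k G
  ∈-derivations P zero G [] _ _ = here refl
  ∈-derivations P (suc k) G [] _ _ = here refl
  ∈-derivations P (suc k) G ((v , i) ∷ gs) eq (s≤s le)
    with v' , p , ev , e , _ , run ← runG-∷ P G v i gs eq
    with refl ← toFin?-toℕ (n G) v ev
    = there (∈-concatMap (∈-allFin v') (∈-concatMap (∈-upTo⁺ (nth-index {s} P i e))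
        (∈-maybe e (∈-map⁺ ((toℕ v' , i) ∷_) (∈-derivations P k (apply G v' p) gs run le)))))

  nodeLabel : Lab s → Maybe (Fin (Sig.nNode s))
  nodeLabel (node N) = just N
  nodeLabel _        = nothing

  decodings : DecSys {s} → ℕ → Graph s → List (List (ℕ × ℕ × ℕ))
  decodings T zero G = [] ∷ []
  decodings T (suc k) G = [] ∷ concatMap (λ v → concatMap (λ w → concatMap (λ α →
      maybe (λ N₁ → maybe (λ N₂ → map ((toℕ v , toℕ w , toℕ α) ∷_) (decodings T k (decodeAt G v w α (T α N₁ N₂))))
        [] (nodeLabel (lab G w))) [] (nodeLabel (lab G v)))
    (allFin (Sig.nEnc s))) (allFin (n G))) (allFin (n G))

  runT-∷ : ∀ (T : DecSys {s}) G v w a ds {K} → runT T G ((v , w , a) ∷ ds) ≡ just K →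
    Σ (Fin (n G)) λ v' → Σ (Fin (n G)) λ w' → Σ (Fin (Sig.nEnc s)) λ α →
    Σ (Fin (Sig.nNode s)) λ N₁ → Σ (Fin (Sig.nNode s)) λ N₂ →
      (toℕ v' , toℕ w' , toℕ α) ≡ (v , w , a) × lab G v' ≡ node N₁ × lab G w' ≡ node N₂ ×
      runT T (decodeAt G v' w' α (T α N₁ N₂)) ds ≡ just K
  runT-∷ T G v w a ds eq
    with toFin? {s} (n G) v in ev | toFin? {s} (n G) w in ew | toFin? {s} (Sig.nEnc s) a in ea
  ... | just v' | just w' | just α with lab G v' in lv | lab G w' in lw
  ...   | node N₁ | node N₂ with edge G v' w' (enc α)
  ...     | true = v' , w' , α , N₁ , N₂
                 , cong₂ _,_ (toFin?-toℕ (n G) v ev) (cong₂ _,_ (toFin?-toℕ (n G) w ew) (toFin?-toℕ (Sig.nEnc s) a ea))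
                 , lv , lw , eq

  ∈-decodings : ∀ T k G ds {K} → runT T G ds ≡ just K → length ds ≤ k → ds ∈ decodings T k G
  ∈-decodings T zero G [] _ _ = here refl
  ∈-decodings T (suc k) G [] _ _ = here refl
  ∈-decodings T (suc k) G ((v , w , a) ∷ ds) eq (s≤s le)
    with v' , w' , α , N₁ , N₂ , refl , lv , lw , run ← runT-∷ T G v w a ds eq
    = there (∈-concatMap (∈-allFin v') (∈-concatMap (∈-allFin w') (∈-concatMap (∈-allFin α)
        (∈-maybe (cong nodeLabel lv) (∈-maybe (cong nodeLabel lw) (∈-map⁺ ((toℕ v' , toℕ w' , toℕ α) ∷_)
          (∈-decodings T k (decodeAt G v' w' α (T α N₁ N₂)) ds run le)))))))

  module Enumeration (B : ESG {s}) (isB : IsBESG B) (me : MatchExhaustive B) where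
    open ESG B
    open StepBound B isB me

    Matched : Graph s → CDeriv → Set
    Matched H d = Σ (Graph s) λ K → (concrete B d ≡ just K) × HasMatching K H

    matched? : ∀ H → IsStringGraph H → ∀ d → Dec (Matched H d)
    matched? H S d with concrete B d
    ... | nothing = no λ ()
    ... | just K = map′ (λ m → K , refl , m)
                        (λ (K' , e , m) → subst (λ K → HasMatching K H) (sym (just-injective e)) m)
                        (hasMatching? K H S)

    candidates : ℕ → List CDeriv
    candidates h = concatMap (λ gs → maybe (λ G → map (gs ,_) (decodings T (4 * h) G)) [] (runG P (startGraph S) gs))
      (derivations P (2 * (4 * h + maxBare)) (startGraph S))

    ∈-candidates : ∀ {H} → IsStringGraph H → ∀ d → Matched H d → d ∈ candidates (n H)
    ∈-candidates {H} SH (gs , ds) (K , eq , m)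
      with G , run , _ , dec ← concrete-inv gs ds eq | lg , ld ← length-bound gs ds SH eq m
      = ∈-concatMap (∈-derivations P _ (startGraph S) gs run lg)
          (∈-maybe run (∈-map⁺ (gs ,_) (∈-decodings T (4 * n H) G ds dec ld)))

    -- The enumeration is a function of the bare graph, chosen before any proof that it is a string
    -- graph, so that property is decided first. The empty list for other graphs is a default
    -- outside the claim.
    enumerate : Graph s → List CDeriv
    enumerate H with isStringGraph? H
    ... | yes SH = filter (matched? H SH) (candidates (n H))
    ... | no _   = []

    enumerate-correct : ∀ H → IsStringGraph H → ∀ d → (d ∈ enumerate H → Matched H d) × (Matched H d → d ∈ enumerate H)
    enumerate-correct H SH d with isStringGraph? H
    ... | no ¬S  = ⊥-elim (¬S SH)
    ... | yes S' = (λ d∈ → proj₂ (∈-filter⁻ (matched? H S') {xs = candidates (n H)} d∈)) ,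
                   (λ m → ∈-filter⁺ (matched? H S') (∈-candidates S' d m) m)

theorem3 : ∀ {s : Sig} (B : ESG {s}) → IsBESG B → MatchExhaustive B →
    Σ (Graph s → List CDeriv) λ enum →
    ∀ (H : Graph s) → IsStringGraph H → ∀ (d : CDeriv) →
    ((d ∈ enum H) → Σ (Graph s) λ K → (concrete B d ≡ just K) × HasMatching K H)
    × ((Σ (Graph s) λ K → (concrete B d ≡ just K) × HasMatching K H) → d ∈ enum H)
theorem3 B isB me = enumerate , enumerate-correct
  where open Enumeration B isB me
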